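{- For $n\ge 3$ let $c_n$ denote the number of optimal strategies for Player I in the Penney-Ante game with strings of length $n$. Then $$c_n=2c_{n-1}-(-1)^n c_{\lfloor n/2\rfloor+1}\qquad\text{for all } n\ge 6.$$
   Context: Penney-Ante game with strings of length $n\ge3$: Player I chooses a string $A\in\{H,T\}^n$; Player II, seeing $A$, chooses a string $B\in\{H,T\}^n$ with $B\ne A$. A fair coin is tossed repeatedly (independent tosses) producing an infinite $H/T$ sequence, and the player whose string first appears as a block of consecutive tosses wins. A string $A$ is an optimal strategy for Player I if it maximizes, over all $A\in\{H,T\}^n$, the quantity $\min_{B\ne A} P(A\text{ appears before }B)$, i.e. Player I's winning probability assuming Player II responds optimally. $c_n$ is the number of such optimal strings $A$ (e.g. $c_3=4$, $c_4=2$, $c_5=2$). -}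

module Defs where

open import Data.Bool using (Bool; true; false; _∧_; _∨_; not; if_then_else_)
open import Data.Bool.Properties using () renaming (_≟_ to _≟B_)
open import Data.Nat using (ℕ; zero; suc; _+_; _*_; _^_; _<_)
open import Data.List using (List; []; _∷_; length; filterᵇ; map; concatMap; inits; reverse)
open import Data.Vec using (Vec; toList)
open import Data.Product using (Σ; ∃; ∃-syntax; _×_)
open import Data.List.Membership.Propositional using (_∈_)
open import Data.List.Relation.Unary.Unique.Propositional using (Unique)
open import Relation.Nullary using (¬_; does)
open import Relation.Binary.PropositionalEquality using (_≡_)
open import Function.Bundles using (_⇔_)

-- Coin tosses: true = H, false = T.  A string of length n is a Vec Bool n.
Str : ℕ → Set
Str n = Vec Bool n

isPrefix : List Bool → List Bool → Bool
isPrefix [] w = true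
isPrefix (x ∷ s) [] = false
isPrefix (x ∷ s) (y ∷ w) = does (x ≟B y) ∧ isPrefix s w

endsWith : List Bool → List Bool → Bool
endsWith s w = isPrefix (reverse s) (reverse w)

data Outcome : Set where
  winA winB neither : Outcome

scan : List Bool → List Bool → List (List Bool) → Outcome
scan A B [] = neither
scan A B (p ∷ ps) =
  if endsWith A p then winA else (if endsWith B p then winB else scan A B ps)

outcome : List Bool → List Bool → List Bool → Outcome
outcome A B w = scan A B (inits w)

isWinA : Outcome → Bool
isWinA winA = true
isWinA winB = false
isWinA neither = false

allWords : ℕ → List (List Bool)
allWords zero = [] ∷ []
allWords (suc N) = concatMap (λ w → (true ∷ w) ∷ (false ∷ w) ∷ []) (allWords N)

-- W N A B = number of the 2^N equally likely sequences of N fair tosses in which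
-- A appears (as a block) before B.  So P(A wins within N tosses) = W N A B / 2^N.
W : ∀ {n} → ℕ → Str n → Str n → ℕ
W N A B = length (filterᵇ (λ w → isWinA (outcome (toList A) (toList B) w)) (allWords N))

-- P(A before B) = lim_N W N A B / 2^N (continuity of probability along the
-- increasing events "A wins within N tosses").  Comparison of two such limits
-- of nondecreasing sequences a_N, b_M:
--   lim a ≤ lim b  iff  ∀ N, ∀ e, ∃ M, a_N < b_M + 2^-e,
-- written with denominators cleared (all in ℕ).
ProbLe : ∀ {n} → Str n → Str n → Str n → Str n → Set
ProbLe A B A' B' =
  ∀ (N e : ℕ) → ∃[ M ] (W N A B * 2 ^ (M + e) < W M A' B' * 2 ^ (N + e) + 2 ^ (N + M))

-- A is optimal for Player I:  max_{A'} min_{B'≠A'} P(A' before B')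
--   ≤ min_{B≠A} P(A before B), i.e. A attains the maximum
-- (minima over finite sets are attained).
Optimal : (n : ℕ) → Str n → Set
Optimal n A =
  ∀ (A' : Str n) → ∃[ B' ] (¬ (B' ≡ A') × (∀ (B : Str n) → ¬ (B ≡ A) → ProbLe A' B' A B))

Count : ∀ {n} → (Str n → Set) → ℕ → Set
Count {n} P k = ∃[ l ] (Unique l × (∀ (x : Str n) → (x ∈ l) ⇔ P x) × length l ≡ k)

{-# OPTIONS --safe #-}
module Submission where

open import Defs
open import Data.Bool using (Bool; true; false; not; _∧_)
open import Data.Bool.Properties using (∧-assoc; ∧-identityʳ; ∧-zeroʳ; ¬-not) renaming (_≟_ to _≟B_)
open import Data.Nat using (ℕ; zero; suc; pred; _≤_; _<_; _∸_; _*_; z≤n; s≤s; s≤s⁻¹; NonZero; >-nonZero; >-nonZero⁻¹; _≤?_; _<?_) renaming (_+_ to _ℕ+_; _^_ to _ℕ^_)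
open import Data.Nat.Properties
open import Data.Nat.DivMod using (_/_; m*n/n≡m; +-distrib-/-∣ʳ)
open import Data.Nat.Divisibility using (n∣m*n)
open import Data.Nat.Tactic.RingSolver using (solve-∀)
open import Data.Integer using (ℤ; +_; -[1+_]; -_; _+_; _^_) renaming (_*_ to _*ℤ_)
import Data.Integer.Properties as ℤ
open import Data.List using (List; []; _∷_; [_]; _++_; length; filterᵇ; map; concatMap; inits; reverse)
open import Data.List.Properties using (unfold-reverse; ++-assoc; map-∘; map-id; ++-identityʳ)
open import Data.List.Membership.Propositional using (_∈_)
open import Data.List.Relation.Unary.Any using (here; there)
open import Data.List.Relation.Unary.AllPairs using ([]; _∷_)
import Data.List.Relation.Unary.All as All
open import Data.List.Relation.Unary.Unique.Propositional using (Unique)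
open import Data.Vec using (Vec; []; _∷_; toList) renaming (_++_ to _++ᵥ_)
open import Data.Vec.Properties using (≡-dec; ∷-injectiveʳ)
open import Data.Product using (∃-syntax; _×_; _,_; proj₁; proj₂)
open import Data.Sum using (_⊎_; inj₁; inj₂; [_,_]′)
open import Data.Empty using (⊥)
open import Function using (_∘_)
open import Function.Bundles using (Equivalence)
open import Relation.Nullary using (¬_; Dec; does; yes; no; contradiction)
open import Relation.Nullary.Decidable using (dec-true; dec-false; map′; _×-dec_; _→-dec_; ¬?)
open import Relation.Binary.PropositionalEquality using (_≡_; _≢_; refl; sym; trans; cong; cong₂; subst; subst₂; module ≡-Reasoning)

-- By Conway's formula the odds of B against A are (AA − AB) : (BB − BA), where XY weighs the overlaps
-- of suffixes of X with prefixes of Y; it comes from a martingale of gamblers betting on A and on B.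
-- Let A′ be A without its last letter, and call A special if A′ starts with x x̄, ends with x̄ x and has
-- no proper border longer than 1, and A = A′x.  If A is not special, then the longest border of A′ tells
-- which of the two replies B = bA′ makes AA − AB at least twice BB − BA.  Special strings keep the odds
-- down to (2^(n-1) + 1) : (2^(n-2) + 1) against every B and are therefore exactly the optimal ones.
-- To count them, remove the middle d ∈ {1, 2} letters of A′.  Only borders up to half the length
-- matter, and putting d letters back into a good pair of halves of length k produces either a good
-- word of length 2k + d or one having a border of length k + 1, which is itself an arbitrary good word.

-- A reply `bA′` overlaps A in n - 1 letters, which halves BB - BA up to shorter overlaps. The odds
-- are therefore near 2 : 1, and the short borders decide on which side they fall. Since (2Q + 1) :
-- (Q + 1) with Q = 2^(n-2) lies strictly below 2 : 1, reaching 2 : 1 already refutes a string, and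
-- the best reply to a non-special string is never computed. No limit is formed: `ProbLe` compares
-- finite counts, so the martingale is stopped after N tosses. The error is proportional to the
-- number of undecided sequences, whose share of 2^N tends to 0. The alternating sign comes from the
-- parity of the length of A′. Let h be the number of good pairs of halves of length k and s the
-- number of good words of length k + 1. There are h good words of length 2k, then 2h - s of length
-- 2k + 1 and 4h - s of length 2k + 2. Doubling overshoots by s in the first step and falls short by
-- s in the second, as 4h - s = 2(2h - s) + s.

Word : Set
Word = ℕ → Bool

-- With total functions as words, prefixes, shifts and prepended letters need no length bookkeeping.
-- The default `false` past the end is harmless: the congruence lemmas ask for agreement below the
-- length only.
at : ∀ {n} → Vec Bool n → Word
at [] i = false
at (x ∷ v) zero = x
at (x ∷ v) (suc i) = at v i

-- Prefixes are reversed because the tosses seen so far are kept latest first: a string has just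
-- appeared iff its reversal is a prefix of that list.
rtake : ℕ → Word → List Bool
rtake zero u = []
rtake (suc j) u = u j ∷ rtake j u

length-rtake : ∀ j u → length (rtake j u) ≡ j
length-rtake zero u = refl
length-rtake (suc j) u = cong suc (length-rtake j u)

rtake-suc : ∀ j u → rtake (suc j) u ≡ rtake j (λ i → u (suc i)) ++ [ u 0 ]
rtake-suc zero u = refl
rtake-suc (suc j) u = cong (u (suc j) ∷_) (rtake-suc j u)

reverse-toList : ∀ {n} (A : Vec Bool n) → reverse (toList A) ≡ rtake n (at A)
reverse-toList [] = refl
reverse-toList {suc n} (x ∷ A) = begin
  reverse (x ∷ toList A)     ≡⟨ unfold-reverse x (toList A) ⟩
  reverse (toList A) ++ [ x ] ≡⟨ cong (_++ [ x ]) (reverse-toList A) ⟩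
  rtake n (at A) ++ [ x ]    ≡⟨ sym (rtake-suc n (at (x ∷ A))) ⟩
  rtake (suc n) (at (x ∷ A)) ∎
  where open ≡-Reasoning

-- Binary weights of overlaps and the capital of the gamblers

𝟙 : Bool → ℕ
𝟙 true = 1
𝟙 false = 0

wsum : (ℕ → Bool) → ℕ → ℕ
wsum f zero = 0
wsum f (suc k) = wsum f k ℕ+ 2 ℕ^ suc k * 𝟙 (f (suc k))

wsum-cong : ∀ {f g} k → (∀ l → 1 ≤ l → l ≤ k → f l ≡ g l) → wsum f k ≡ wsum g k
wsum-cong zero eq = refl
wsum-cong (suc k) eq = cong₂ (λ s b → s ℕ+ 2 ℕ^ suc k * 𝟙 b)
  (wsum-cong k (λ l 1≤l l≤k → eq l 1≤l (m≤n⇒m≤1+n l≤k))) (eq (suc k) (s≤s z≤n) ≤-refl)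

𝟙≤1 : ∀ b → 𝟙 b ≤ 1
𝟙≤1 true = ≤-refl
𝟙≤1 false = z≤n

-- The weights 2, 4, ..., 2^k sum to 2^(k+1) - 2. In the later estimates the spare 2 pays for the
-- empty border.
wsum-upper : ∀ f k → wsum f k ℕ+ 2 ≤ 2 ℕ^ suc k
wsum-upper f zero = ≤-refl
wsum-upper f (suc k) = begin
  wsum f k ℕ+ P * 𝟙 (f (suc k)) ℕ+ 2   ≤⟨ +-monoˡ-≤ 2 (+-monoʳ-≤ (wsum f k) (*-monoʳ-≤ P (𝟙≤1 (f (suc k))))) ⟩
  wsum f k ℕ+ P * 1 ℕ+ 2               ≡⟨ lem (wsum f k) P ⟩
  (wsum f k ℕ+ 2) ℕ+ P                 ≤⟨ +-monoˡ-≤ P (wsum-upper f k) ⟩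
  P ℕ+ P                               ≡⟨ cong (P ℕ+_) (sym (+-identityʳ P)) ⟩
  2 * P ∎
  where
  open ≤-Reasoning
  P = 2 ℕ^ suc k
  lem : ∀ w p → w ℕ+ p * 1 ℕ+ 2 ≡ (w ℕ+ 2) ℕ+ p
  lem = solve-∀

isPrefix-++ : ∀ s p t → length s ≤ length p → isPrefix s (p ++ t) ≡ isPrefix s p
isPrefix-++ [] p t le = refl
isPrefix-++ (x ∷ s) (y ∷ p) t (s≤s le) = cong (does (x ≟B y) ∧_) (isPrefix-++ s p t le)

isPrefix-split : ∀ s w → isPrefix s w ≡ true → ∃[ t ] w ≡ s ++ t
isPrefix-split [] w h = w , refl
isPrefix-split (true ∷ s) (true ∷ w) h with isPrefix-split s w h
... | t , refl = t , refl
isPrefix-split (false ∷ s) (false ∷ w) h with isPrefix-split s w h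
... | t , refl = t , refl

-- The capital, just after the tosses whose reversal is r, of the gamblers who bet on u.
score : ℕ → Word → List Bool → ℕ
score k u r = wsum (λ j → isPrefix (rtake j u) r) k

-- Twice Conway's leading number of u over v.
conway : ℕ → Word → Word → ℕ
conway n u v = score n v (rtake n u)

score-[] : ∀ k u → score k u [] ≡ 0
score-[] zero u = refl
score-[] (suc k) u rewrite score-[] k u = *-zeroʳ (2 ℕ^ suc k)

score-ends : ∀ n u v r → isPrefix (rtake n u) r ≡ true → score n v r ≡ conway n u v
score-ends n u v r h with isPrefix-split (rtake n u) r h
... | t , refl = wsum-cong n λ l _ l≤n → isPrefix-++ (rtake l v) (rtake n u) t
  (subst₂ _≤_ (sym (length-rtake l v)) (sym (length-rtake n u)) l≤n)

𝟙-split : ∀ b p → 𝟙 (does (b ≟B true) ∧ p) ℕ+ 𝟙 (does (b ≟B false) ∧ p) ≡ 𝟙 p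
𝟙-split true p = +-identityʳ (𝟙 p)
𝟙-split false p = refl

-- One gambler enters with stake 1 before each toss and everybody plays double or nothing, so the
-- two outcomes together hold twice the old capital plus stake. A gambler who has seen all of `u`
-- stops; the last summand on the left restores his share.
score-step : ∀ k u r →
  score k u (true ∷ r) ℕ+ score k u (false ∷ r) ℕ+ 2 ℕ^ suc k * 𝟙 (isPrefix (rtake k u) r)
    ≡ 2 * (1 ℕ+ score k u r)
score-step zero u r = refl
score-step (suc k) u r = begin
  s₁ ℕ+ P * i₁ ℕ+ (s₂ ℕ+ P * i₂) ℕ+ 2 * P * j   ≡⟨ lem₁ s₁ s₂ P i₁ i₂ j ⟩
  s₁ ℕ+ s₂ ℕ+ P * (i₁ ℕ+ i₂) ℕ+ 2 * P * j       ≡⟨ cong (λ z → s₁ ℕ+ s₂ ℕ+ P * z ℕ+ 2 * P * j) (𝟙-split (u k) _) ⟩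
  s₁ ℕ+ s₂ ℕ+ P * 𝟙 (isPrefix (rtake k u) r) ℕ+ 2 * P * j ≡⟨ cong (_ℕ+ 2 * P * j) (score-step k u r) ⟩
  2 * (1 ℕ+ score k u r) ℕ+ 2 * P * j           ≡⟨ lem₂ (score k u r) P j ⟩
  2 * (1 ℕ+ (score k u r ℕ+ P * j)) ∎
  where
  open ≡-Reasoning
  P = 2 ℕ^ suc k
  s₁ = score k u (true ∷ r)
  s₂ = score k u (false ∷ r)
  i₁ = 𝟙 (isPrefix (rtake (suc k) u) (true ∷ r))
  i₂ = 𝟙 (isPrefix (rtake (suc k) u) (false ∷ r))
  j = 𝟙 (isPrefix (rtake (suc k) u) r)
  lem₁ : ∀ s₁ s₂ P i₁ i₂ j → s₁ ℕ+ P * i₁ ℕ+ (s₂ ℕ+ P * i₂) ℕ+ 2 * P * j ≡ s₁ ℕ+ s₂ ℕ+ P * (i₁ ℕ+ i₂) ℕ+ 2 * P * j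
  lem₁ = solve-∀
  lem₂ : ∀ s P j → 2 * (1 ℕ+ s) ℕ+ 2 * P * j ≡ 2 * (1 ℕ+ (s ℕ+ P * j))
  lem₂ = solve-∀

score-live : ∀ k u r → isPrefix (rtake k u) r ≡ false →
  score k u (true ∷ r) ℕ+ score k u (false ∷ r) ≡ 2 * (1 ℕ+ score k u r)
score-live k u r h = begin
  s ≡⟨ sym (+-identityʳ s) ⟩
  s ℕ+ 0 ≡⟨ cong (s ℕ+_) (sym (*-zeroʳ (2 ℕ^ suc k))) ⟩
  s ℕ+ 2 ℕ^ suc k * 𝟙 false ≡⟨ cong (λ b → s ℕ+ 2 ℕ^ suc k * 𝟙 b) (sym h) ⟩
  s ℕ+ 2 ℕ^ suc k * 𝟙 (isPrefix (rtake k u) r) ≡⟨ score-step k u r ⟩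
  2 * (1 ℕ+ score k u r) ∎
  where
  open ≡-Reasoning
  s = score k u (true ∷ r) ℕ+ score k u (false ∷ r)

-- The race between two strings and the decay of undecided games

bernoulli : ∀ q k → q ℕ^ k * (q ℕ+ k) ≤ q * suc q ℕ^ k
bernoulli q zero = ≤-reflexive (lem q)
  where
  lem : ∀ q → 1 * (q ℕ+ 0) ≡ q * 1
  lem = solve-∀
bernoulli q (suc k) = begin
  q * Q * (q ℕ+ suc k)               ≡⟨ lem₁ q Q k ⟩
  Q * q ℕ+ q * (Q * (q ℕ+ k))        ≤⟨ +-monoˡ-≤ _ (*-monoʳ-≤ Q (m≤m+n q k)) ⟩
  Q * (q ℕ+ k) ℕ+ q * (Q * (q ℕ+ k)) ≤⟨ +-mono-≤ (bernoulli q k) (*-monoʳ-≤ q (bernoulli q k)) ⟩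
  q * R ℕ+ q * (q * R)               ≡⟨ lem₂ q R ⟩
  q * (suc q * R) ∎
  where
  open ≤-Reasoning
  Q = q ℕ^ k
  R = suc q ℕ^ k
  lem₁ : ∀ q Q k → q * Q * (q ℕ+ suc k) ≡ Q * q ℕ+ q * (Q * (q ℕ+ k))
  lem₁ = solve-∀
  lem₂ : ∀ q R → q * R ℕ+ q * (q * R) ≡ q * (suc q * R)
  lem₂ = solve-∀

-- By Bernoulli, (1 + 1/q)^(qK) ≥ 1 + K.
power-gap : ∀ q .{{_ : NonZero q}} K → ∃[ k ] q ℕ^ k * K < suc q ℕ^ k
power-gap q K = q * K , *-cancelˡ-< q _ _ (begin-strict
  q * (Q * K)        <⟨ m<m+n (q * (Q * K)) (*-mono-≤ (m^n>0 q (q * K)) (>-nonZero⁻¹ q)) ⟩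
  q * (Q * K) ℕ+ Q * q ≡⟨ lem q Q K ⟩
  Q * (q ℕ+ q * K)   ≤⟨ bernoulli q (q * K) ⟩
  q * suc q ℕ^ (q * K) ∎)
  where
  open ≤-Reasoning
  Q = q ℕ^ (q * K)
  lem : ∀ q Q K → q * (Q * K) ℕ+ Q * q ≡ Q * (q ℕ+ q * K)
  lem = solve-∀

module Race (n : ℕ) (u v : Word) where

  data Status (r : List Bool) : Set where
    wonA : isPrefix (rtake n u) r ≡ true → Status r
    wonB : isPrefix (rtake n u) r ≡ false → isPrefix (rtake n v) r ≡ true → Status r
    live : isPrefix (rtake n u) r ≡ false → isPrefix (rtake n v) r ≡ false → Status r

  status : ∀ r → Status r
  status r with isPrefix (rtake n u) r in a | isPrefix (rtake n v) r in b
  ... | true  | _     = wonA a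
  ... | false | true  = wonB a b
  ... | false | false = live a b

  wins alive : ℕ → List Bool → ℕ
  wins N r with isPrefix (rtake n u) r | isPrefix (rtake n v) r | N
  ... | true  | _     | _      = 2 ℕ^ N
  ... | false | true  | _      = 0
  ... | false | false | zero   = 0
  ... | false | false | suc N′ = wins N′ (true ∷ r) ℕ+ wins N′ (false ∷ r)
  alive N r with isPrefix (rtake n u) r | isPrefix (rtake n v) r | N
  ... | true  | _     | _      = 0
  ... | false | true  | _      = 0
  ... | false | false | zero   = 1
  ... | false | false | suc N′ = alive N′ (true ∷ r) ℕ+ alive N′ (false ∷ r)

  wins-wonA : ∀ N {r} → isPrefix (rtake n u) r ≡ true → wins N r ≡ 2 ℕ^ N
  wins-wonA N a rewrite a = refl

  wins-wonB : ∀ N {r} → isPrefix (rtake n u) r ≡ false → isPrefix (rtake n v) r ≡ true → wins N r ≡ 0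
  wins-wonB N a b rewrite a | b = refl

  wins-live-0 : ∀ {r} → isPrefix (rtake n u) r ≡ false → isPrefix (rtake n v) r ≡ false → wins 0 r ≡ 0
  wins-live-0 a b rewrite a | b = refl

  wins-live-suc : ∀ N {r} → isPrefix (rtake n u) r ≡ false → isPrefix (rtake n v) r ≡ false →
    wins (suc N) r ≡ wins N (true ∷ r) ℕ+ wins N (false ∷ r)
  wins-live-suc N a b rewrite a | b = refl

  alive-wonA : ∀ N {r} → isPrefix (rtake n u) r ≡ true → alive N r ≡ 0
  alive-wonA N a rewrite a = refl

  alive-wonB : ∀ N {r} → isPrefix (rtake n u) r ≡ false → isPrefix (rtake n v) r ≡ true → alive N r ≡ 0
  alive-wonB N a b rewrite a | b = refl

  alive-live-0 : ∀ {r} → isPrefix (rtake n u) r ≡ false → isPrefix (rtake n v) r ≡ false → alive 0 r ≡ 1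
  alive-live-0 a b rewrite a | b = refl

  alive-live-suc : ∀ N {r} → isPrefix (rtake n u) r ≡ false → isPrefix (rtake n v) r ≡ false →
    alive (suc N) r ≡ alive N (true ∷ r) ℕ+ alive N (false ∷ r)
  alive-live-suc N a b rewrite a | b = refl

  wins-mono : ∀ N r → 2 * wins N r ≤ wins (suc N) r
  wins-mono N r with status r
  ... | wonA a rewrite wins-wonA N {r} a | wins-wonA (suc N) {r} a = ≤-refl
  ... | wonB a b rewrite wins-wonB N {r} a b = z≤n
  wins-mono zero r | live a b rewrite wins-live-0 {r} a b = z≤n
  wins-mono (suc N) r | live a b
    rewrite wins-live-suc N {r} a b | wins-live-suc (suc N) {r} a b = begin
      2 * (wins N (true ∷ r) ℕ+ wins N (false ∷ r)) ≡⟨ *-distribˡ-+ 2 (wins N (true ∷ r)) _ ⟩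
      2 * wins N (true ∷ r) ℕ+ 2 * wins N (false ∷ r) ≤⟨ +-mono-≤ (wins-mono N (true ∷ r)) (wins-mono N (false ∷ r)) ⟩
      wins (suc N) (true ∷ r) ℕ+ wins (suc N) (false ∷ r) ∎
    where open ≤-Reasoning

  wins-mono* : ∀ k N r → 2 ℕ^ k * wins N r ≤ wins (k ℕ+ N) r
  wins-mono* zero N r = ≤-reflexive (+-identityʳ (wins N r))
  wins-mono* (suc k) N r = begin
    2 * 2 ℕ^ k * wins N r   ≡⟨ *-assoc 2 (2 ℕ^ k) (wins N r) ⟩
    2 * (2 ℕ^ k * wins N r) ≤⟨ *-monoʳ-≤ 2 (wins-mono* k N r) ⟩
    2 * wins (k ℕ+ N) r     ≤⟨ wins-mono (k ℕ+ N) r ⟩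
    wins (suc k ℕ+ N) r     ∎
    where open ≤-Reasoning

  alive≤ : ∀ N r → alive N r ≤ 2 ℕ^ N
  alive≤ N r with status r
  ... | wonA a rewrite alive-wonA N {r} a = z≤n
  ... | wonB a b rewrite alive-wonB N {r} a b = z≤n
  alive≤ zero r | live a b rewrite alive-live-0 {r} a b = ≤-refl
  alive≤ (suc N) r | live a b rewrite alive-live-suc N {r} a b =
    ≤-trans (+-mono-≤ (alive≤ N (true ∷ r)) (alive≤ N (false ∷ r)))
            (≤-reflexive (cong (2 ℕ^ N ℕ+_) (sym (+-identityʳ (2 ℕ^ N)))))

  -- From any live position, tossing the rest of u ends the game.
  alive-< : ∀ j i r → i ℕ+ j ≡ n → isPrefix (rtake i u) r ≡ true → alive j r < 2 ℕ^ j
  alive-< zero i r refl h rewrite alive-wonA 0 {r} (trans (cong (λ k → isPrefix (rtake k u) r) (+-identityʳ i)) h) = ≤-refl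
  alive-< (suc j) i r e h with status r
  ... | wonA a rewrite alive-wonA (suc j) {r} a = m^n>0 2 (suc j)
  ... | wonB a b rewrite alive-wonB (suc j) {r} a b = m^n>0 2 (suc j)
  ... | live a b rewrite alive-live-suc j {r} a b with u i in eq
  ...   | true = ≤-trans (+-mono-<-≤ (alive-< j (suc i) (true ∷ r) (trans (sym (+-suc i j)) e) h′) (alive≤ j (false ∷ r)))
                  (≤-reflexive (cong (2 ℕ^ j ℕ+_) (sym (+-identityʳ (2 ℕ^ j)))))
    where
    h′ : isPrefix (rtake (suc i) u) (true ∷ r) ≡ true
    h′ rewrite eq = h
  ...   | false = ≤-trans (+-mono-≤-< (alive≤ j (true ∷ r)) (alive-< j (suc i) (false ∷ r) (trans (sym (+-suc i j)) e) h′))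
                  (≤-reflexive (cong (2 ℕ^ j ℕ+_) (sym (+-identityʳ (2 ℕ^ j)))))
    where
    h′ : isPrefix (rtake (suc i) u) (false ∷ r) ≡ true
    h′ rewrite eq = h

  alive-mult : ∀ k c → (∀ r → alive k r ≤ c) → ∀ N r → alive (N ℕ+ k) r ≤ c * alive N r
  alive-mult k c hyp N r with status r
  ... | wonA a rewrite alive-wonA (N ℕ+ k) {r} a = z≤n
  ... | wonB a b rewrite alive-wonB (N ℕ+ k) {r} a b = z≤n
  alive-mult k c hyp zero r | live a b rewrite alive-live-0 {r} a b = ≤-trans (hyp r) (≤-reflexive (sym (*-identityʳ c)))
  alive-mult k c hyp (suc N) r | live a b
    rewrite alive-live-suc (N ℕ+ k) {r} a b | alive-live-suc N {r} a b =
      ≤-trans (+-mono-≤ (alive-mult k c hyp N (true ∷ r)) (alive-mult k c hyp N (false ∷ r)))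
              (≤-reflexive (sym (*-distribˡ-+ c (alive N (true ∷ r)) _)))

  alive-power : ∀ k q → (∀ r → alive k r ≤ q) → ∀ j → alive (j * k) [] ≤ q ℕ^ j
  alive-power k q hyp zero = alive≤ 0 []
  alive-power k q hyp (suc j) = begin
    alive (k ℕ+ j * k) []  ≡⟨ cong (λ z → alive z []) (+-comm k (j * k)) ⟩
    alive (j * k ℕ+ k) []  ≤⟨ alive-mult k q hyp (j * k) [] ⟩
    q * alive (j * k) []   ≤⟨ *-monoʳ-≤ q (alive-power k q hyp j) ⟩
    q * q ℕ^ j ∎
    where open ≤-Reasoning

  -- From every position at least one of the next 2^n blocks of n tosses ends the game. With q = 2^n
  -- - 1, at most q^k of the (q + 1)^k sequences of k blocks stay undecided.
  alive-vanishes : .{{_ : NonZero n}} → ∀ K → ∃[ M ] alive M [] * K < 2 ℕ^ M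
  alive-vanishes K = conclude (power-gap q {{qnz}} K)
    where
    q = pred (2 ℕ^ n)
    sq : suc q ≡ 2 ℕ^ n
    sq = suc-pred (2 ℕ^ n) {{>-nonZero (m^n>0 2 n)}}
    qnz : NonZero q
    qnz = >-nonZero (+-cancelˡ-≤ 1 1 q (≤-trans (lem n) (≤-reflexive (sym sq))))
      where
      lem : ∀ n .{{_ : NonZero n}} → 2 ≤ 2 ℕ^ n
      lem (suc n) = *-monoʳ-≤ 2 (m^n>0 2 n)
    conclude : ∃[ k ] q ℕ^ k * K < suc q ℕ^ k → ∃[ M ] alive M [] * K < 2 ℕ^ M
    conclude (k , lt) = k * n , (begin-strict
      alive (k * n) [] * K ≤⟨ *-monoˡ-≤ K (alive-power n q (λ r → +-cancelˡ-≤ 1 _ _ (≤-trans (alive-< n 0 r refl refl) (≤-reflexive (sym sq)))) k) ⟩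
      q ℕ^ k * K           <⟨ lt ⟩
      suc q ℕ^ k           ≡⟨ cong (_ℕ^ k) sq ⟩
      (2 ℕ^ n) ℕ^ k        ≡⟨ ^-*-assoc 2 n k ⟩
      2 ℕ^ (n * k)         ≡⟨ cong (2 ℕ^_) (*-comm n k) ⟩
      2 ℕ^ (k * n) ∎)
      where open ≤-Reasoning

  -- The martingale stopped at a finite horizon

  module Odds (x y : ℕ) (hx : conway n u u ≡ conway n u v ℕ+ x) (hy : conway n v v ≡ conway n v u ℕ+ y) where

    open ≤-Reasoning

    -- Bounds the absolute value of y + score u - score v, the amount by which an undecided sequence
    -- can falsify the balance.
    bound : ℕ
    bound = y ℕ+ 2 ℕ^ suc n

    score≤ : ∀ w r → score n w r ≤ 2 ℕ^ suc n
    score≤ w r = ≤-trans (m≤m+n _ 2) (wsum-upper _ n)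

    -- y + score u − score v is a martingale while the game is live; it equals x + y once A
    -- has won and 0 once B has won.
    wins≤ : ∀ N r → (x ℕ+ y) * wins N r ℕ+ 2 ℕ^ N * score n v r
                      ≤ 2 ℕ^ N * (y ℕ+ score n u r) ℕ+ bound * alive N r
    wins≤ N r with status r
    ... | wonA a rewrite wins-wonA N {r} a | alive-wonA N {r} a | score-ends n u u r a | score-ends n u v r a | hx
        = ≤-reflexive (lem (2 ℕ^ N) x y (conway n u v) bound)
      where
      lem : ∀ P x y c b → (x ℕ+ y) * P ℕ+ P * c ≡ P * (y ℕ+ (c ℕ+ x)) ℕ+ b * 0
      lem = solve-∀
    ... | wonB a b rewrite wins-wonB N {r} a b | alive-wonB N {r} a b | score-ends n v u r b | score-ends n v v r b | hy
        = ≤-reflexive (lem (2 ℕ^ N) x y (conway n v u) bound)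
      where
      lem : ∀ P x y c b → (x ℕ+ y) * 0 ℕ+ P * (c ℕ+ y) ≡ P * (y ℕ+ c) ℕ+ b * 0
      lem = solve-∀
    wins≤ zero r | live a b rewrite wins-live-0 {r} a b | alive-live-0 {r} a b = begin
      (x ℕ+ y) * 0 ℕ+ 1 * score n v r ≡⟨ lem x y (score n v r) ⟩
      score n v r                     ≤⟨ score≤ v r ⟩
      2 ℕ^ suc n                      ≤⟨ m≤n+m _ y ⟩
      bound                           ≤⟨ m≤n+m bound (1 * (y ℕ+ score n u r)) ⟩
      1 * (y ℕ+ score n u r) ℕ+ bound ≡⟨ cong (1 * (y ℕ+ score n u r) ℕ+_) (sym (*-identityʳ bound)) ⟩
      1 * (y ℕ+ score n u r) ℕ+ bound * 1 ∎
      where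
      lem : ∀ x y c → (x ℕ+ y) * 0 ℕ+ 1 * c ≡ c
      lem = solve-∀
    -- The cancelled `P * 2` is the new stake, which enters the scores of `u` and of `v` alike; this
    -- is why their difference is a fair game.
    wins≤ (suc N) r | live a b rewrite wins-live-suc N {r} a b | alive-live-suc N {r} a b = +-cancelʳ-≤ (P * 2) _ _ (begin
      (x ℕ+ y) * (w₁ ℕ+ w₂) ℕ+ 2 * P * score n v r ℕ+ P * 2   ≡⟨ lem₁ x y w₁ w₂ P (score n v r) ⟩
      (x ℕ+ y) * (w₁ ℕ+ w₂) ℕ+ P * (2 * (1 ℕ+ score n v r))   ≡⟨ cong (λ z → (x ℕ+ y) * (w₁ ℕ+ w₂) ℕ+ P * z) (sym (score-live n v r b)) ⟩
      (x ℕ+ y) * (w₁ ℕ+ w₂) ℕ+ P * (v₁ ℕ+ v₂)                 ≡⟨ lem₂ (x ℕ+ y) w₁ w₂ P v₁ v₂ ⟩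
      ((x ℕ+ y) * w₁ ℕ+ P * v₁) ℕ+ ((x ℕ+ y) * w₂ ℕ+ P * v₂) ≤⟨ +-mono-≤ (wins≤ N (true ∷ r)) (wins≤ N (false ∷ r)) ⟩
      (P * (y ℕ+ u₁) ℕ+ bound * a₁) ℕ+ (P * (y ℕ+ u₂) ℕ+ bound * a₂) ≡⟨ lem₃ P y u₁ u₂ bound a₁ a₂ ⟩
      P * (2 * y ℕ+ (u₁ ℕ+ u₂)) ℕ+ bound * (a₁ ℕ+ a₂)         ≡⟨ cong (λ z → P * (2 * y ℕ+ z) ℕ+ bound * (a₁ ℕ+ a₂)) (score-live n u r a) ⟩
      P * (2 * y ℕ+ 2 * (1 ℕ+ score n u r)) ℕ+ bound * (a₁ ℕ+ a₂) ≡⟨ lem₄ P y (score n u r) (bound * (a₁ ℕ+ a₂)) ⟩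
      2 * P * (y ℕ+ score n u r) ℕ+ bound * (a₁ ℕ+ a₂) ℕ+ P * 2 ∎)
      where
      P = 2 ℕ^ N
      w₁ = wins N (true ∷ r)
      w₂ = wins N (false ∷ r)
      a₁ = alive N (true ∷ r)
      a₂ = alive N (false ∷ r)
      u₁ = score n u (true ∷ r)
      u₂ = score n u (false ∷ r)
      v₁ = score n v (true ∷ r)
      v₂ = score n v (false ∷ r)
      lem₁ : ∀ x y w₁ w₂ P s → (x ℕ+ y) * (w₁ ℕ+ w₂) ℕ+ 2 * P * s ℕ+ P * 2 ≡ (x ℕ+ y) * (w₁ ℕ+ w₂) ℕ+ P * (2 * (1 ℕ+ s))
      lem₁ = solve-∀
      lem₂ : ∀ t w₁ w₂ P v₁ v₂ → t * (w₁ ℕ+ w₂) ℕ+ P * (v₁ ℕ+ v₂) ≡ (t * w₁ ℕ+ P * v₁) ℕ+ (t * w₂ ℕ+ P * v₂)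
      lem₂ = solve-∀
      lem₃ : ∀ P y u₁ u₂ b a₁ a₂ → (P * (y ℕ+ u₁) ℕ+ b * a₁) ℕ+ (P * (y ℕ+ u₂) ℕ+ b * a₂) ≡ P * (2 * y ℕ+ (u₁ ℕ+ u₂)) ℕ+ b * (a₁ ℕ+ a₂)
      lem₃ = solve-∀
      lem₄ : ∀ P y s c → P * (2 * y ℕ+ 2 * (1 ℕ+ s)) ℕ+ c ≡ 2 * P * (y ℕ+ s) ℕ+ c ℕ+ P * 2
      lem₄ = solve-∀

    wins≥ : ∀ N r → 2 ℕ^ N * (y ℕ+ score n u r)
                      ≤ (x ℕ+ y) * wins N r ℕ+ 2 ℕ^ N * score n v r ℕ+ bound * alive N r
    wins≥ N r with status r
    ... | wonA a rewrite wins-wonA N {r} a | alive-wonA N {r} a | score-ends n u u r a | score-ends n u v r a | hx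
        = ≤-reflexive (lem (2 ℕ^ N) x y (conway n u v) bound)
      where
      lem : ∀ P x y c b → P * (y ℕ+ (c ℕ+ x)) ≡ (x ℕ+ y) * P ℕ+ P * c ℕ+ b * 0
      lem = solve-∀
    ... | wonB a b rewrite wins-wonB N {r} a b | alive-wonB N {r} a b | score-ends n v u r b | score-ends n v v r b | hy
        = ≤-reflexive (lem (2 ℕ^ N) x y (conway n v u) bound)
      where
      lem : ∀ P x y c b → P * (y ℕ+ c) ≡ (x ℕ+ y) * 0 ℕ+ P * (c ℕ+ y) ℕ+ b * 0
      lem = solve-∀
    wins≥ zero r | live a b rewrite wins-live-0 {r} a b | alive-live-0 {r} a b = begin
      1 * (y ℕ+ score n u r) ≡⟨ *-identityˡ (y ℕ+ score n u r) ⟩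
      y ℕ+ score n u r       ≤⟨ +-monoʳ-≤ y (score≤ u r) ⟩
      bound                  ≡⟨ sym (*-identityʳ bound) ⟩
      bound * 1              ≤⟨ m≤n+m _ ((x ℕ+ y) * 0 ℕ+ 1 * score n v r) ⟩
      (x ℕ+ y) * 0 ℕ+ 1 * score n v r ℕ+ bound * 1 ∎
    wins≥ (suc N) r | live a b rewrite wins-live-suc N {r} a b | alive-live-suc N {r} a b = +-cancelʳ-≤ (P * 2) _ _ (begin
      2 * P * (y ℕ+ score n u r) ℕ+ P * 2                     ≡⟨ lem₁ P y (score n u r) ⟩
      P * (2 * y ℕ+ 2 * (1 ℕ+ score n u r))                   ≡⟨ cong (λ z → P * (2 * y ℕ+ z)) (sym (score-live n u r a)) ⟩
      P * (2 * y ℕ+ (u₁ ℕ+ u₂))                               ≡⟨ lem₂ P y u₁ u₂ ⟩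
      P * (y ℕ+ u₁) ℕ+ P * (y ℕ+ u₂)                          ≤⟨ +-mono-≤ (wins≥ N (true ∷ r)) (wins≥ N (false ∷ r)) ⟩
      ((x ℕ+ y) * w₁ ℕ+ P * v₁ ℕ+ bound * a₁) ℕ+ ((x ℕ+ y) * w₂ ℕ+ P * v₂ ℕ+ bound * a₂) ≡⟨ lem₃ (x ℕ+ y) w₁ w₂ P v₁ v₂ bound a₁ a₂ ⟩
      (x ℕ+ y) * (w₁ ℕ+ w₂) ℕ+ P * (v₁ ℕ+ v₂) ℕ+ bound * (a₁ ℕ+ a₂) ≡⟨ cong (λ z → (x ℕ+ y) * (w₁ ℕ+ w₂) ℕ+ P * z ℕ+ bound * (a₁ ℕ+ a₂)) (score-live n v r b) ⟩
      (x ℕ+ y) * (w₁ ℕ+ w₂) ℕ+ P * (2 * (1 ℕ+ score n v r)) ℕ+ bound * (a₁ ℕ+ a₂) ≡⟨ lem₄ ((x ℕ+ y) * (w₁ ℕ+ w₂)) P (score n v r) (bound * (a₁ ℕ+ a₂)) ⟩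
      (x ℕ+ y) * (w₁ ℕ+ w₂) ℕ+ 2 * P * score n v r ℕ+ bound * (a₁ ℕ+ a₂) ℕ+ P * 2 ∎)
      where
      P = 2 ℕ^ N
      w₁ = wins N (true ∷ r)
      w₂ = wins N (false ∷ r)
      a₁ = alive N (true ∷ r)
      a₂ = alive N (false ∷ r)
      u₁ = score n u (true ∷ r)
      u₂ = score n u (false ∷ r)
      v₁ = score n v (true ∷ r)
      v₂ = score n v (false ∷ r)
      lem₁ : ∀ P y s → 2 * P * (y ℕ+ s) ℕ+ P * 2 ≡ P * (2 * y ℕ+ 2 * (1 ℕ+ s))
      lem₁ = solve-∀
      lem₂ : ∀ P y u₁ u₂ → P * (2 * y ℕ+ (u₁ ℕ+ u₂)) ≡ P * (y ℕ+ u₁) ℕ+ P * (y ℕ+ u₂)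
      lem₂ = solve-∀
      lem₃ : ∀ t w₁ w₂ P v₁ v₂ b a₁ a₂ → (t * w₁ ℕ+ P * v₁ ℕ+ b * a₁) ℕ+ (t * w₂ ℕ+ P * v₂ ℕ+ b * a₂) ≡ t * (w₁ ℕ+ w₂) ℕ+ P * (v₁ ℕ+ v₂) ℕ+ b * (a₁ ℕ+ a₂)
      lem₃ = solve-∀
      lem₄ : ∀ s P c d → s ℕ+ P * (2 * (1 ℕ+ c)) ℕ+ d ≡ s ℕ+ 2 * P * c ℕ+ d ℕ+ P * 2
      lem₄ = solve-∀

    wins-[]≤ : ∀ N → (x ℕ+ y) * wins N [] ≤ 2 ℕ^ N * y ℕ+ bound * alive N []
    wins-[]≤ N = begin
      (x ℕ+ y) * wins N []                           ≤⟨ m≤m+n _ _ ⟩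
      (x ℕ+ y) * wins N [] ℕ+ 2 ℕ^ N * score n v []  ≤⟨ wins≤ N [] ⟩
      2 ℕ^ N * (y ℕ+ score n u []) ℕ+ bound * alive N [] ≡⟨ cong (λ z → 2 ℕ^ N * z ℕ+ bound * alive N []) (trans (cong (y ℕ+_) (score-[] n u)) (+-identityʳ y)) ⟩
      2 ℕ^ N * y ℕ+ bound * alive N [] ∎

    wins-[]≥ : ∀ N → 2 ℕ^ N * y ≤ (x ℕ+ y) * wins N [] ℕ+ bound * alive N []
    wins-[]≥ N = begin
      2 ℕ^ N * y                                     ≤⟨ *-monoʳ-≤ (2 ℕ^ N) (m≤m+n y _) ⟩
      2 ℕ^ N * (y ℕ+ score n u [])                   ≤⟨ wins≥ N [] ⟩
      (x ℕ+ y) * wins N [] ℕ+ 2 ℕ^ N * score n v [] ℕ+ bound * alive N []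
        ≡⟨ cong (λ z → (x ℕ+ y) * wins N [] ℕ+ z ℕ+ bound * alive N []) (trans (cong (2 ℕ^ N *_) (score-[] n v)) (*-zeroʳ (2 ℕ^ N))) ⟩
      (x ℕ+ y) * wins N [] ℕ+ 0 ℕ+ bound * alive N [] ≡⟨ cong (_ℕ+ bound * alive N []) (+-identityʳ _) ⟩
      (x ℕ+ y) * wins N [] ℕ+ bound * alive N [] ∎

    module _ .{{_ : NonZero n}} where

      odds-approx : ∀ e → ∃[ M ] 2 ℕ^ M * y * 2 ℕ^ e < (x ℕ+ y) * wins M [] * 2 ℕ^ e ℕ+ 2 ℕ^ M
      odds-approx e with alive-vanishes (bound * 2 ℕ^ e)
      ... | M , lt = M , (begin-strict
        2 ℕ^ M * y * E                                         ≤⟨ *-monoˡ-≤ E (wins-[]≥ M) ⟩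
        ((x ℕ+ y) * wins M [] ℕ+ bound * alive M []) * E       ≡⟨ lem ((x ℕ+ y) * wins M []) bound (alive M []) E ⟩
        (x ℕ+ y) * wins M [] * E ℕ+ alive M [] * (bound * E)   <⟨ +-monoʳ-< ((x ℕ+ y) * wins M [] * E) lt ⟩
        (x ℕ+ y) * wins M [] * E ℕ+ 2 ℕ^ M ∎)
        where
        E = 2 ℕ^ e
        lem : ∀ t b a E → (t ℕ+ b * a) * E ≡ t * E ℕ+ a * (b * E)
        lem = solve-∀

      odds-upper : ∀ N → (x ℕ+ y) * wins N [] ≤ 2 ℕ^ N * y
      odds-upper N = ≮⇒≥ λ gt → impossible gt (alive-vanishes (bound * 2 ℕ^ N))
        where
        Q = 2 ℕ^ N
        impossible : Q * y < (x ℕ+ y) * wins N [] → ∃[ M ] alive M [] * (bound * Q) < 2 ℕ^ M → ⊥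
        impossible gt (M , lt) = <-irrefl refl (begin-strict
          2 ℕ^ M * suc (Q * y)                       ≤⟨ *-monoʳ-≤ (2 ℕ^ M) gt ⟩
          2 ℕ^ M * ((x ℕ+ y) * wins N [])            ≡⟨ lem₁ (2 ℕ^ M) (x ℕ+ y) (wins N []) ⟩
          (x ℕ+ y) * (2 ℕ^ M * wins N [])            ≤⟨ *-monoʳ-≤ (x ℕ+ y) (wins-mono* M N []) ⟩
          (x ℕ+ y) * wins (M ℕ+ N) []                ≤⟨ wins-[]≤ (M ℕ+ N) ⟩
          2 ℕ^ (M ℕ+ N) * y ℕ+ bound * alive (M ℕ+ N) [] ≤⟨ +-monoʳ-≤ _ (*-monoʳ-≤ bound (alive-mult N Q (alive≤ N) M [])) ⟩
          2 ℕ^ (M ℕ+ N) * y ℕ+ bound * (Q * alive M []) ≡⟨ cong₂ _ℕ+_ (cong (_* y) (^-distribˡ-+-* 2 M N)) (lem₂ bound Q (alive M [])) ⟩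
          2 ℕ^ M * Q * y ℕ+ alive M [] * (bound * Q) <⟨ +-monoʳ-< (2 ℕ^ M * Q * y) lt ⟩
          2 ℕ^ M * Q * y ℕ+ 2 ℕ^ M                   ≡⟨ lem₃ (2 ℕ^ M) Q y ⟩
          2 ℕ^ M * suc (Q * y) ∎)
          where
          lem₁ : ∀ P t w → P * (t * w) ≡ t * (P * w)
          lem₁ = solve-∀
          lem₂ : ∀ b q a → b * (q * a) ≡ a * (b * q)
          lem₂ = solve-∀
          lem₃ : ∀ P q y → P * q * y ℕ+ P ≡ P * suc (q * y)
          lem₃ = solve-∀

-- From scanning initial segments to the race

resolve : List Bool → List Bool → List Bool → List Bool → Outcome
resolve a b r w with isPrefix a r | isPrefix b r | w
... | true  | _     | _      = winA
... | false | true  | _      = winB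
... | false | false | []     = neither
... | false | false | c ∷ w′ = resolve a b (c ∷ r) w′

-- `scan` rereads every initial segment, `resolve` carries the reversed one along. The function `f`
-- prepends the letters already read; `inits` builds it up by mapping over its tail.
scan-resolve : ∀ A B (f : List Bool → List Bool) r → (∀ q → reverse (f q) ≡ reverse q ++ r) →
  ∀ w → scan A B (map f (inits w)) ≡ resolve (reverse A) (reverse B) r w
scan-resolve A B f r hf w rewrite hf [] with isPrefix (reverse A) r | isPrefix (reverse B) r | w
... | true  | _     | _      = refl
... | false | true  | _      = refl
... | false | false | []     = refl
... | false | false | c ∷ w′ = trans (cong (scan A B) (sym (map-∘ (inits w′))))
    (scan-resolve A B (λ q → f (c ∷ q)) (c ∷ r) hf′ w′)
  where
  hf′ : ∀ q → reverse (f (c ∷ q)) ≡ reverse q ++ (c ∷ r)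
  hf′ q = trans (hf (c ∷ q)) (trans (cong (_++ r) (unfold-reverse c q)) (++-assoc (reverse q) [ c ] r))

outcome-resolve : ∀ A B w → outcome A B w ≡ resolve (reverse A) (reverse B) [] w
outcome-resolve A B w = trans (cong (scan A B) (sym (map-id (inits w))))
  (scan-resolve A B (λ q → q) [] (λ q → sym (++-identityʳ (reverse q))) w)

count : (List Bool → Bool) → List (List Bool) → ℕ
count p ws = length (filterᵇ p ws)

count-cong : ∀ {p q} ws → (∀ w → p w ≡ q w) → count p ws ≡ count q ws
count-cong [] eq = refl
count-cong {p} {q} (w ∷ ws) eq with p w | q w | eq w
... | true  | true  | _ = cong suc (count-cong ws eq)
... | false | false | _ = count-cong ws eq

count-∷ : ∀ p w ws → count p (w ∷ ws) ≡ 𝟙 (p w) ℕ+ count p ws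
count-∷ p w ws with p w
... | true  = refl
... | false = refl

count-suc : ∀ p ws → count p (concatMap (λ w → (true ∷ w) ∷ (false ∷ w) ∷ []) ws)
                       ≡ count (p ∘ (true ∷_)) ws ℕ+ count (p ∘ (false ∷_)) ws
count-suc p [] = refl
count-suc p (w ∷ ws)
  rewrite count-∷ p (true ∷ w) ((false ∷ w) ∷ concatMap (λ w → (true ∷ w) ∷ (false ∷ w) ∷ []) ws)
        | count-∷ p (false ∷ w) (concatMap (λ w → (true ∷ w) ∷ (false ∷ w) ∷ []) ws)
        | count-∷ (p ∘ (true ∷_)) w ws | count-∷ (p ∘ (false ∷_)) w ws | count-suc p ws
  = lem (𝟙 (p (true ∷ w))) (𝟙 (p (false ∷ w))) _ _
  where
  lem : ∀ a b c d → a ℕ+ (b ℕ+ (c ℕ+ d)) ≡ a ℕ+ c ℕ+ (b ℕ+ d)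
  lem = solve-∀

count-true : ∀ N → count (λ _ → true) (allWords N) ≡ 2 ℕ^ N
count-true zero = refl
count-true (suc N) = trans (count-suc (λ _ → true) (allWords N))
  (cong₂ _ℕ+_ (count-true N) (trans (count-true N) (sym (+-identityʳ (2 ℕ^ N)))))

count-false : ∀ ws → count (λ _ → false) ws ≡ 0
count-false [] = refl
count-false (w ∷ ws) = count-false ws

resolve-wonA : ∀ a b r w → isPrefix a r ≡ true → resolve a b r w ≡ winA
resolve-wonA a b r w h rewrite h = refl

resolve-wonB : ∀ a b r w → isPrefix a r ≡ false → isPrefix b r ≡ true → resolve a b r w ≡ winB
resolve-wonB a b r w h₁ h₂ rewrite h₁ | h₂ = refl

resolve-live-[] : ∀ a b r → isPrefix a r ≡ false → isPrefix b r ≡ false → resolve a b r [] ≡ neither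
resolve-live-[] a b r h₁ h₂ rewrite h₁ | h₂ = refl

resolve-live-∷ : ∀ a b r c w → isPrefix a r ≡ false → isPrefix b r ≡ false →
  resolve a b r (c ∷ w) ≡ resolve a b (c ∷ r) w
resolve-live-∷ a b r c w h₁ h₂ rewrite h₁ | h₂ = refl

count-wins : ∀ n u v N r →
  count (λ w → isWinA (resolve (rtake n u) (rtake n v) r w)) (allWords N) ≡ Race.wins n u v N r
count-wins n u v N r with Race.status n u v r
... | Race.wonA a = begin
    _ ≡⟨ count-cong (allWords N) (λ w → cong isWinA (resolve-wonA (rtake n u) (rtake n v) r w a)) ⟩
    _ ≡⟨ count-true N ⟩
    _ ≡⟨ sym (Race.wins-wonA n u v N a) ⟩
    _ ∎
  where open ≡-Reasoning
... | Race.wonB a b = begin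
    _ ≡⟨ count-cong (allWords N) (λ w → cong isWinA (resolve-wonB (rtake n u) (rtake n v) r w a b)) ⟩
    _ ≡⟨ count-false (allWords N) ⟩
    _ ≡⟨ sym (Race.wins-wonB n u v N a b) ⟩
    _ ∎
  where open ≡-Reasoning
count-wins n u v zero r | Race.live a b = begin
    _ ≡⟨ count-∷ (λ w → isWinA (resolve (rtake n u) (rtake n v) r w)) [] [] ⟩
    _ ≡⟨ cong (λ o → 𝟙 (isWinA o) ℕ+ 0) (resolve-live-[] (rtake n u) (rtake n v) r a b) ⟩
    _ ≡⟨ sym (Race.wins-live-0 n u v a b) ⟩
    _ ∎
  where open ≡-Reasoning
count-wins n u v (suc N) r | Race.live a b = begin
    _ ≡⟨ count-suc _ (allWords N) ⟩
    _ ≡⟨ cong₂ _ℕ+_ (step true) (step false) ⟩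
    _ ≡⟨ sym (Race.wins-live-suc n u v N a b) ⟩
    _ ∎
  where
  open ≡-Reasoning
  step : ∀ c → count (λ w → isWinA (resolve (rtake n u) (rtake n v) r (c ∷ w))) (allWords N) ≡ Race.wins n u v N (c ∷ r)
  step c = trans (count-cong (allWords N) (λ w → cong isWinA (resolve-live-∷ (rtake n u) (rtake n v) r c w a b))) (count-wins n u v N (c ∷ r))

W≡wins : ∀ {n} N (A B : Str n) → W N A B ≡ Race.wins n (at A) (at B) N []
W≡wins {n} N A B = trans (count-cong (allWords N) eq) (count-wins n (at A) (at B) N [])
  where
  eq : ∀ w → isWinA (outcome (toList A) (toList B) w) ≡ isWinA (resolve (rtake n (at A)) (rtake n (at B)) [] w)
  eq w rewrite outcome-resolve (toList A) (toList B) w | reverse-toList A | reverse-toList B = refl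

-- Conway numbers and borders

-- Used when a letter is prepended: every overlap gets one letter longer, its weight doubles, and
-- the empty overlap becomes one of length 1.
wsum-shift : ∀ f k → wsum f (suc k) ≡ 2 * (𝟙 (f 1) ℕ+ wsum (f ∘ suc) k)
wsum-shift f zero = lem (𝟙 (f 1))
  where
  lem : ∀ a → 2 * a ≡ 2 * (a ℕ+ 0)
  lem = solve-∀
wsum-shift f (suc k) rewrite wsum-shift f k = lem (𝟙 (f 1)) (wsum (f ∘ suc) k) (2 ℕ^ suc k) (𝟙 (f (suc (suc k))))
  where
  lem : ∀ a w p b → 2 * (a ℕ+ w) ℕ+ 2 * p * b ≡ 2 * (a ℕ+ (w ℕ+ p * b))
  lem = solve-∀

wsum-vanish : ∀ f k j → (∀ l → j < l → l ≤ k → f l ≡ false) → wsum f k ℕ+ 2 ≤ 2 ℕ^ suc j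
wsum-vanish f zero j van = *-monoʳ-≤ 2 (m^n>0 2 j)
wsum-vanish f (suc k) j van with suc k ≤? j
... | yes k<j = ≤-trans (wsum-upper f (suc k)) (^-monoʳ-≤ 2 (s≤s k<j))
... | no k≮j rewrite van (suc k) (≰⇒> k≮j) ≤-refl | *-zeroʳ (2 ℕ^ suc k) | +-identityʳ (wsum f k) =
      wsum-vanish f k j (λ l j<l l≤k → van l j<l (m≤n⇒m≤1+n l≤k))

wsum-zero : ∀ f k → (∀ l → 1 ≤ l → l ≤ k → f l ≡ false) → wsum f k ≡ 0
wsum-zero f k van = n≤0⇒n≡0 (+-cancelʳ-≤ 2 _ _ (wsum-vanish f k 0 van))

wsum-mono : ∀ f {j k} → j ≤ k → wsum f j ≤ wsum f k
wsum-mono f {j} {k} j≤k with m≤n⇒m<n∨m≡n j≤k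
... | inj₂ refl = ≤-refl
wsum-mono f {j} {suc k} _ | inj₁ (s≤s j≤k) = ≤-trans (wsum-mono f j≤k) (m≤m+n _ _)

wsum-term : ∀ f {j k} → suc j ≤ k → f (suc j) ≡ true → 2 ℕ^ suc j ≤ wsum f k
wsum-term f {j} j≤k h = ≤-trans
  (subst (λ b → 2 ℕ^ suc j ≤ wsum f j ℕ+ 2 ℕ^ suc j * 𝟙 b) (sym h)
    (≤-trans (≤-reflexive (sym (*-identityʳ (2 ℕ^ suc j)))) (m≤n+m _ _)))
  (wsum-mono f j≤k)

wsum-full : ∀ f j → (∀ l → 1 ≤ l → l ≤ j → f l ≡ true) → 2 ℕ^ suc j ≤ wsum f j ℕ+ 2
wsum-full f zero all = ≤-refl
wsum-full f (suc j) all rewrite all (suc j) (s≤s z≤n) ≤-refl = begin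
  2 * P                  ≡⟨ cong (P ℕ+_) (+-identityʳ P) ⟩
  P ℕ+ P                 ≤⟨ +-monoˡ-≤ P (wsum-full f j (λ l 1≤l l≤j → all l 1≤l (m≤n⇒m≤1+n l≤j))) ⟩
  wsum f j ℕ+ 2 ℕ+ P     ≡⟨ lem (wsum f j) P ⟩
  wsum f j ℕ+ P * 1 ℕ+ 2 ∎
  where
  open ≤-Reasoning
  P = 2 ℕ^ suc j
  lem : ∀ w P → w ℕ+ 2 ℕ+ P ≡ w ℕ+ P * 1 ℕ+ 2
  lem = solve-∀

wsum-single : ∀ f k j → (∀ l → 1 ≤ l → l ≢ j → l ≤ k → f l ≡ false) → wsum f k ≤ 2 ℕ^ j
wsum-single f zero j only = z≤n
wsum-single f (suc k) j only with suc k ≟ j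
... | yes refl rewrite wsum-zero f k (λ l 1≤l l≤k → only l 1≤l (<⇒≢ (s≤s l≤k)) (m≤n⇒m≤1+n l≤k)) =
      ≤-trans (*-monoʳ-≤ (2 ℕ^ suc k) (𝟙≤1 (f (suc k)))) (≤-reflexive (*-identityʳ (2 ℕ^ suc k)))
... | no k≢j rewrite only (suc k) (s≤s z≤n) k≢j ≤-refl | *-zeroʳ (2 ℕ^ suc k) | +-identityʳ (wsum f k) =
      wsum-single f k j (λ l 1≤l l≢j l≤k → only l 1≤l l≢j (m≤n⇒m≤1+n l≤k))

wsum-split : ∀ (f : ℕ → Bool) (g : ℕ → Bool) b k →
  wsum f k ≡ wsum (λ l → f l ∧ does (b ≟B g l)) k ℕ+ wsum (λ l → f l ∧ does (not b ≟B g l)) k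
wsum-split f g b zero = refl
wsum-split f g b (suc k) = begin
  wsum f k ℕ+ P * 𝟙 (f (suc k)) ≡⟨ cong₂ (λ x y → x ℕ+ P * y) (wsum-split f g b k) (pt (f (suc k)) b (g (suc k))) ⟩
  w₁ ℕ+ w₂ ℕ+ P * (i₁ ℕ+ i₂)    ≡⟨ lem w₁ w₂ P i₁ i₂ ⟩
  w₁ ℕ+ P * i₁ ℕ+ (w₂ ℕ+ P * i₂) ∎
  where
  open ≡-Reasoning
  P = 2 ℕ^ suc k
  w₁ = wsum (λ l → f l ∧ does (b ≟B g l)) k
  w₂ = wsum (λ l → f l ∧ does (not b ≟B g l)) k
  i₁ = 𝟙 (f (suc k) ∧ does (b ≟B g (suc k)))
  i₂ = 𝟙 (f (suc k) ∧ does (not b ≟B g (suc k)))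
  pt : ∀ x b c → 𝟙 x ≡ 𝟙 (x ∧ does (b ≟B c)) ℕ+ 𝟙 (x ∧ does (not b ≟B c))
  pt true true true = refl
  pt true true false = refl
  pt true false true = refl
  pt true false false = refl
  pt false b c = refl
  lem : ∀ w₁ w₂ P i₁ i₂ → w₁ ℕ+ w₂ ℕ+ P * (i₁ ℕ+ i₂) ≡ w₁ ℕ+ P * i₁ ℕ+ (w₂ ℕ+ P * i₂)
  lem = solve-∀

does-true⇒≡ : ∀ b c → does (b ≟B c) ≡ true → b ≡ c
does-true⇒≡ true true _ = refl
does-true⇒≡ false false _ = refl

∧-true : ∀ {a b} → a ∧ b ≡ true → a ≡ true × b ≡ true
∧-true {true} {true} _ = refl , refl

-- The prefix of v of length j is a suffix of the prefix of u of length n.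
ends : ℕ → ℕ → Word → Word → Bool
ends j n v u = isPrefix (rtake j v) (rtake n u)

ends⇒ : ∀ j p {v u} → ends j (j ℕ+ p) v u ≡ true → ∀ i → i < j → v i ≡ u (i ℕ+ p)
ends⇒ (suc j) p h i i<sj with ∧-true h | m<1+n⇒m<n∨m≡n i<sj
... | h₁ , h₂ | inj₁ i<j  = ends⇒ j p h₂ i i<j
... | h₁ , h₂ | inj₂ refl = does-true⇒≡ _ _ h₁

ends⇐ : ∀ j p {v u} → (∀ i → i < j → v i ≡ u (i ℕ+ p)) → ends j (j ℕ+ p) v u ≡ true
ends⇐ zero p h = refl
ends⇐ (suc j) p {v} {u} h = cong₂ _∧_ (dec-true (v j ≟B u (j ℕ+ p)) (h j ≤-refl)) (ends⇐ j p (λ i i<j → h i (m≤n⇒m≤1+n i<j)))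

ends-cong : ∀ j n {v v′ u u′} → (∀ i → i < j → v i ≡ v′ i) → (∀ i → i < n → u i ≡ u′ i) →
  ends j n v u ≡ ends j n v′ u′
ends-cong zero n hv hu = refl
ends-cong (suc j) zero hv hu = refl
ends-cong (suc j) (suc n) hv hu =
  cong₂ _∧_ (cong₂ (λ b c → does (b ≟B c)) (hv j ≤-refl) (hu n ≤-refl))
    (ends-cong j n (λ i i<j → hv i (m≤n⇒m≤1+n i<j)) (λ i i<n → hu i (m≤n⇒m≤1+n i<n)))

ends-refl : ∀ n u → ends n n u u ≡ true
ends-refl n u = trans (cong (λ k → ends n k u u) (sym (+-identityʳ n)))
  (ends⇐ n 0 (λ i _ → cong u (sym (+-identityʳ i))))

ends-full : ∀ n {v u} → ends n n v u ≡ true → ∀ i → i < n → v i ≡ u i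
ends-full n {v} {u} h i i<n = trans (ends⇒ n 0 (trans (cong (λ k → ends n k v u) (+-identityʳ n)) h) i i<n) (cong u (+-identityʳ i))

infixr 5 _▸_
_▸_ : Bool → Word → Word
(b ▸ u) zero = b
(b ▸ u) (suc i) = u i

ends-▸ʳ : ∀ j m {v} b u → j ≤ m → ends j (suc m) v (b ▸ u) ≡ ends j m v u
ends-▸ʳ zero m b u _ = refl
ends-▸ʳ (suc j) (suc m) {v} b u (s≤s j≤m) = cong (does (v j ≟B u m) ∧_) (ends-▸ʳ j m b u j≤m)

ends-▸ˡ : ∀ j n b {v u} → j < n → ends (suc j) n (b ▸ v) u ≡ ends j n v u ∧ does (b ≟B u (n ∸ suc j))
ends-▸ˡ zero (suc n) b {v} {u} _ = ∧-identityʳ _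
ends-▸ˡ (suc j) (suc n) b {v} {u} (s≤s j<n) = trans (cong (does (v j ≟B u n) ∧_) (ends-▸ˡ j n b j<n)) (sym (∧-assoc (does (v j ≟B u n)) _ _))

border : ℕ → ℕ → Word → Bool
border l m u = ends l m u u

-- The border of length `l`, read at the end of the word, has `b` in front of it, so that the prefix
-- of `b ▸ u` of length `l` + 1 ends the word. Overlaps with a reply bA′ thus become borders sorted
-- by the letter before them. For `l` = 0 the condition is that the last letter is `b`.
preceded : Bool → ℕ → Word → ℕ → Bool
preceded b m u l = border l m u ∧ does (b ≟B u (m ∸ suc l))

conway-self : ∀ m u → conway (suc m) u u ≡ wsum (λ l → border l (suc m) u) m ℕ+ 2 ℕ^ suc m
conway-self m u rewrite ends-refl (suc m) u = cong (wsum (λ l → border l (suc m) u) m ℕ+_) (*-identityʳ (2 ℕ^ suc m))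

conway-≢ : ∀ m {u v} → ends (suc m) (suc m) v u ≡ false → conway (suc m) u v ≡ wsum (λ j → ends j (suc m) v u) m
conway-≢ m {u} {v} h rewrite h | *-zeroʳ (2 ℕ^ suc m) = +-identityʳ _

conway-▸ʳ : ∀ m u b → conway (suc m) u (b ▸ u) ≡ 2 * (𝟙 (preceded b (suc m) u 0) ℕ+ wsum (preceded b (suc m) u) m)
conway-▸ʳ m u b = trans (wsum-shift _ m)
  (cong₂ (λ a w → 2 * (𝟙 a ℕ+ w)) (ends-▸ˡ 0 (suc m) b {u} {u} (s≤s z≤n))
    (wsum-cong m (λ l _ l≤m → ends-▸ˡ l (suc m) b {u} {u} (s≤s l≤m))))

conway-▸▸ : ∀ m u b → conway (suc (suc m)) (b ▸ u) (b ▸ u)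
  ≡ 2 * (𝟙 (preceded b (suc m) u 0) ℕ+ wsum (preceded b (suc m) u) m) ℕ+ 2 ℕ^ suc (suc m)
conway-▸▸ m u b = trans (conway-self (suc m) (b ▸ u)) (cong (_ℕ+ 2 ℕ^ suc (suc m))
  (trans (wsum-shift _ m) (cong₂ (λ a w → 2 * (𝟙 a ℕ+ w)) (step 0 z≤n) (wsum-cong m (λ l _ l≤m → step l l≤m)))))
  where
  step : ∀ l → l ≤ m → ends (suc l) (suc (suc m)) (b ▸ u) (b ▸ u) ≡ preceded b (suc m) u l
  step l l≤m = begin
    ends (suc l) (suc (suc m)) (b ▸ u) (b ▸ u)                    ≡⟨ ends-▸ˡ l (suc (suc m)) b (s≤s (m≤n⇒m≤1+n l≤m)) ⟩
    ends l (suc (suc m)) u (b ▸ u) ∧ does (b ≟B (b ▸ u) (suc m ∸ l)) ≡⟨ cong₂ _∧_ (ends-▸ʳ l (suc m) b u (m≤n⇒m≤1+n l≤m)) (cong (λ k → does (b ≟B (b ▸ u) k)) (+-∸-assoc 1 l≤m)) ⟩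
    preceded b (suc m) u l ∎
    where open ≡-Reasoning

-- A letter other than `b` prevents `b ▸ u` from agreeing with `u`, which would force a constant
-- word and add a full overlap. The largest remaining overlap is A′ itself, the separate power of
-- two.
conway-▸ˡ : ∀ m u b → (∃[ i ] (i < suc (suc m) × u i ≢ b)) →
  conway (suc (suc m)) (b ▸ u) u ≡ wsum (λ l → border l (suc m) u) m ℕ+ 2 ℕ^ suc m
conway-▸ˡ m u b (i , i<n , ui≢b) = begin
  conway (suc (suc m)) (b ▸ u) u                         ≡⟨ conway-≢ (suc m) ne ⟩
  wsum (λ j → ends j (suc (suc m)) u (b ▸ u)) (suc m)    ≡⟨ wsum-cong (suc m) (λ l _ l≤m → ends-▸ʳ l (suc m) b u l≤m) ⟩
  wsum (λ j → border j (suc m) u) (suc m)                ≡⟨ cong (λ c → wsum (λ j → border j (suc m) u) m ℕ+ 2 ℕ^ suc m * 𝟙 c) (ends-refl (suc m) u) ⟩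
  wsum (λ j → border j (suc m) u) m ℕ+ 2 ℕ^ suc m * 1    ≡⟨ cong (wsum (λ j → border j (suc m) u) m ℕ+_) (*-identityʳ (2 ℕ^ suc m)) ⟩
  wsum (λ j → border j (suc m) u) m ℕ+ 2 ℕ^ suc m ∎
  where
  open ≡-Reasoning
  const : (∀ i → i < suc (suc m) → u i ≡ (b ▸ u) i) → ∀ i → i < suc (suc m) → u i ≡ b
  const h zero lt = h 0 lt
  const h (suc i) lt = trans (h (suc i) lt) (const h i (<-trans (n<1+n i) lt))
  ne : ends (suc (suc m)) (suc (suc m)) u (b ▸ u) ≡ false
  ne with ends (suc (suc m)) (suc (suc m)) u (b ▸ u) in eq
  ... | true  = contradiction (const (ends-full (suc (suc m)) eq) i i<n) ui≢b
  ... | false = refl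

not-≢ : ∀ b → b ≢ not b
not-≢ true ()
not-≢ false ()

last-true : ∀ (f : ℕ → Bool) k → f 0 ≡ true →
  ∃[ K ] (K ≤ k × f K ≡ true × (∀ l → K < l → l ≤ k → f l ≡ false))
last-true f zero h = 0 , z≤n , h , λ l 0<l l≤0 → contradiction (<-≤-trans 0<l l≤0) (n≮n 0)
last-true f (suc k) h with f (suc k) in eq
... | true = suc k , ≤-refl , eq , λ l k<l l≤k → contradiction (<-≤-trans k<l l≤k) (n≮n (suc k))
... | false with last-true f k h
...   | K , K≤k , fK , beyond = K , m≤n⇒m≤1+n K≤k , fK , beyond′
  where
  beyond′ : ∀ l → K < l → l ≤ suc k → f l ≡ false
  beyond′ l K<l l≤sk with m≤n⇒m<n∨m≡n l≤sk
  ... | inj₁ (s≤s l≤k) = beyond l K<l l≤k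
  ... | inj₂ refl = eq

preceded-border : ∀ b m u l → border l m u ≡ false → preceded b m u l ≡ false
preceded-border b m u l h rewrite h = refl

preceded-≢ : ∀ b m u l → b ≢ u (m ∸ suc l) → preceded b m u l ≡ false
preceded-≢ b m u l ne rewrite dec-false (b ≟B u (m ∸ suc l)) ne = ∧-zeroʳ _

preceded-≡ : ∀ b m u l → border l m u ≡ true → b ≡ u (m ∸ suc l) → preceded b m u l ≡ true
preceded-≡ b m u l h e rewrite h = dec-true (b ≟B u (m ∸ suc l)) e

border-shorten : ∀ m u l → border l m u ≡ false → border (suc l) (suc m) u ≡ false
border-shorten m u l h rewrite h = ∧-zeroʳ _

border-extend : ∀ m u l → border l m u ≡ true → u l ≡ u m → border (suc l) (suc m) u ≡ true
border-extend m u l h e rewrite h = trans (∧-identityʳ _) (dec-true (u l ≟B u m) e)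

border-≢ : ∀ m u l → u l ≢ u m → border (suc l) (suc m) u ≡ false
border-≢ m u l ne rewrite dec-false (u l ≟B u m) ne = refl

-- Special strings, and replies to all others

record Framed (h m : ℕ) (u : Word) : Set where
  field
    start      : u 1 ≢ u 0
    end        : u m ≡ u 0
    end′       : u (m ∸ 1) ≢ u 0
    unbordered : ∀ l → 2 ≤ l → l ≤ h → border l (suc m) u ≡ false

Special : ℕ → Word → Set
Special m u = Framed m m u

-- This is 2(BB - BA) ≤ AA - AB for B = bA′, once the borders of A′ and of A are split by the letter
-- before them and common terms are cancelled. Borders of A′ (length m + 1) count twice, those of A
-- (length m + 2) once; the separate `𝟙` terms belong to the empty border.
Worse : Bool → ℕ → Word → Set
Worse b m u =
  4 * 𝟙 (preceded b (suc m) u 0) ℕ+ 2 * wsum (preceded b (suc m) u) m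
    ℕ+ (2 * 𝟙 (preceded b (suc (suc m)) u 0) ℕ+ wsum (preceded b (suc (suc m)) u) (suc m))
  ≤ 2 * wsum (preceded (not b) (suc m) u) m ℕ+ wsum (preceded (not b) (suc (suc m)) u) (suc m)

-- u is the word A; its prefix A′ of length 1 + m has K as its longest border of length at most m.
module Longest (m : ℕ) (u : Word) (K : ℕ) (K≤m : K ≤ m) (hK : border K (suc m) u ≡ true)
               (beyond : ∀ l → K < l → l ≤ m → border l (suc m) u ≡ false) where

  M n : ℕ
  M = suc m
  n = suc M

  open ≤-Reasoning

  beyond-n : ∀ l → suc K < l → l ≤ M → border l n u ≡ false
  beyond-n (suc l) (s≤s K<l) (s≤s l≤m) = border-shorten M u l (beyond l K<l l≤m)

  -- u (m ∸ K) precedes both the border of length K of A′ and the possible border of length K + 1 of A.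
  beyond-n-≢ : ∀ b → (border (suc K) n u ≡ false ⊎ b ≢ u (m ∸ K)) → ∀ l → K < l → l ≤ M → preceded b n u l ≡ false
  beyond-n-≢ b h l K<l l≤M with m≤n⇒m<n∨m≡n K<l
  ... | inj₁ sK<l = preceded-border b n u l (beyond-n l sK<l l≤M)
  beyond-n-≢ b (inj₁ h) l K<l l≤M | inj₂ refl = preceded-border b n u (suc K) h
  beyond-n-≢ b (inj₂ ne) l K<l l≤M | inj₂ refl = preceded-≢ b n u (suc K) ne

  beyond-≢ : ∀ b → b ≢ u (m ∸ K) → ∀ l → K ≤ l → l ≤ m → preceded b M u l ≡ false
  beyond-≢ b ne l K≤l l≤m with m≤n⇒m<n∨m≡n K≤l
  ... | inj₁ K<l = preceded-border b M u l (beyond l K<l l≤m)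
  ... | inj₂ refl = preceded-≢ b M u K ne

  head : Bool → ℕ
  head b = 4 * 𝟙 (preceded b M u 0) ℕ+ 2 * wsum (preceded b M u) m

  head-bound : ∀ b j → (∀ l → j < l → l ≤ m → preceded b M u l ≡ false) → head b ≤ 2 ℕ^ suc (suc j)
  head-bound b j van = begin
    4 * 𝟙 (preceded b M u 0) ℕ+ 2 * w ≤⟨ +-monoˡ-≤ (2 * w) (*-monoʳ-≤ 4 (𝟙≤1 (preceded b M u 0))) ⟩
    4 ℕ+ 2 * w                        ≡⟨ lem w ⟩
    2 * (w ℕ+ 2)                      ≤⟨ *-monoʳ-≤ 2 (wsum-vanish _ m j van) ⟩
    2 * 2 ℕ^ suc j ∎
    where
    w = wsum (preceded b M u) m
    lem : ∀ w → 4 ℕ+ 2 * w ≡ 2 * (w ℕ+ 2)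
    lem = solve-∀

  tail : Bool → ℕ
  tail b = 2 * 𝟙 (preceded b n u 0) ℕ+ wsum (preceded b n u) M

  tail-bound : ∀ b j → (∀ l → j < l → l ≤ M → preceded b n u l ≡ false) → tail b ≤ 2 ℕ^ suc j
  tail-bound b j van = begin
    2 * 𝟙 (preceded b n u 0) ℕ+ w ≤⟨ +-monoˡ-≤ w (*-monoʳ-≤ 2 (𝟙≤1 (preceded b n u 0))) ⟩
    2 ℕ+ w                        ≡⟨ +-comm 2 w ⟩
    w ℕ+ 2                        ≤⟨ wsum-vanish _ M j van ⟩
    2 ℕ^ suc j ∎
    where
    w = wsum (preceded b n u) M

  ≢⇒not : ∀ {b c : Bool} → b ≢ c → not b ≡ c
  ≢⇒not {true} {true} ne = contradiction refl ne
  ≢⇒not {true} {false} ne = refl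
  ≢⇒not {false} {true} ne = refl
  ≢⇒not {false} {false} ne = contradiction refl ne

  -- The longest border K is preceded by `not b`, and its weight alone is at least that of all
  -- shorter borders together, the empty one included.
  head≤ : ∀ b → b ≢ u (m ∸ K) → head b ≤ 2 * wsum (preceded (not b) M u) m
  head≤ b ne = go K refl
    where
    go : ∀ k → k ≡ K → head b ≤ 2 * wsum (preceded (not b) M u) m
    go zero refl rewrite preceded-≢ b M u 0 ne
      | wsum-zero (preceded b M u) m (λ l 1≤l l≤m → beyond-≢ b ne l z≤n l≤m) = z≤n
    go (suc k) refl = begin
      head b      ≤⟨ head-bound b k (λ l k<l l≤m → beyond-≢ b ne l k<l l≤m) ⟩
      2 * 2 ℕ^ suc k ≤⟨ *-monoʳ-≤ 2 (wsum-term (preceded (not b) M u) K≤m (preceded-≡ (not b) M u K hK (≢⇒not ne))) ⟩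
      2 * wsum (preceded (not b) M u) m ∎

  extends : ∀ b → b ≢ u (m ∸ K) → border (suc K) n u ≡ true → Worse b m u
  extends b ne h = +-mono-≤ (head≤ b ne) (begin
    tail b                       ≤⟨ tail-bound b K (beyond-n-≢ b (inj₂ ne)) ⟩
    2 ℕ^ suc K                   ≤⟨ wsum-term (preceded (not b) n u) (s≤s K≤m) (preceded-≡ (not b) n u (suc K) h (≢⇒not ne)) ⟩
    wsum (preceded (not b) n u) M ∎)

  -- If A′ has no border of length K - 1, then A has none of length K. Both sums on the side of `b`
  -- lose their top terms and are at most 2^K each, and the doubled weight of the border K covers
  -- the two.
  no-second : ∀ b k → K ≡ suc (suc k) → b ≢ u (m ∸ K) → border (suc K) n u ≡ false → border (suc k) M u ≡ false → Worse b m u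
  no-second b k refl ne h h′ = begin
    head b ℕ+ tail b                   ≤⟨ +-mono-≤ (head-bound b k van) (tail-bound b (suc k) van-n) ⟩
    2 ℕ^ K ℕ+ 2 ℕ^ K                   ≡⟨ cong (2 ℕ^ K ℕ+_) (sym (+-identityʳ (2 ℕ^ K))) ⟩
    2 * 2 ℕ^ K                         ≤⟨ *-monoʳ-≤ 2 (wsum-term (preceded (not b) M u) K≤m (preceded-≡ (not b) M u K hK (≢⇒not ne))) ⟩
    2 * wsum (preceded (not b) M u) m  ≤⟨ m≤m+n _ _ ⟩
    2 * wsum (preceded (not b) M u) m ℕ+ wsum (preceded (not b) n u) M ∎
    where
    van : ∀ l → k < l → l ≤ m → preceded b M u l ≡ false
    van l k<l l≤m with m≤n⇒m<n∨m≡n k<l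
    ... | inj₁ sk<l = beyond-≢ b ne l sk<l l≤m
    ... | inj₂ refl = preceded-border b M u (suc k) h′
    van-n : ∀ l → suc k < l → l ≤ M → preceded b n u l ≡ false
    van-n l sk<l l≤M with m≤n⇒m<n∨m≡n sk<l
    ... | inj₁ ssk<l = beyond-n-≢ b (inj₁ h) l ssk<l l≤M
    ... | inj₂ refl = preceded-border b n u (suc (suc k)) (border-shorten M u (suc k) h′)

  module Constant (0<K : 0 < K) (const : ∀ i → i < K → u i ≡ u 0) where

    x : Bool
    x = u 0

    suffix-const : ∀ l → l < K → u (m ∸ l) ≡ x
    suffix-const l l<K = trans (cong u idx) (trans (sym (ends⇒ K (M ∸ K) (trans (cong (λ k → ends K k u u) (m+[n∸m]≡n (m≤n⇒m≤1+n K≤m))) hK) (K ∸ suc l) lt)) (const (K ∸ suc l) lt))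
      where
      lt : K ∸ suc l < K
      lt = ∸-monoʳ-< {K} {suc l} {0} (s≤s z≤n) l<K
      idx : m ∸ l ≡ (K ∸ suc l) ℕ+ (M ∸ K)
      idx = begin-equality
        m ∸ l                 ≡⟨ cong (_∸ suc l) (sym (m∸n+n≡m (m≤n⇒m≤1+n K≤m))) ⟩
        (M ∸ K) ℕ+ K ∸ suc l      ≡⟨ +-∸-assoc (M ∸ K) l<K ⟩
        (M ∸ K) ℕ+ (K ∸ suc l)    ≡⟨ +-comm (M ∸ K) _ ⟩
        (K ∸ suc l) ℕ+ (M ∸ K) ∎

    border-const : ∀ l → l < K → border l M u ≡ true
    border-const l l<K = trans (cong (λ k → ends l k u u) (sym (m+[n∸m]≡n l≤M))) (ends⇐ l (M ∸ l) λ i i<l →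
      trans (const i (<-trans i<l l<K)) (sym (trans (cong u (idx i i<l)) (suffix-const (l ∸ suc i) (≤-<-trans (m∸n≤m l (suc i)) l<K)))))
      where
      l≤M : l ≤ M
      l≤M = ≤-trans (<⇒≤ l<K) (m≤n⇒m≤1+n K≤m)
      idx : ∀ i → i < l → i ℕ+ (M ∸ l) ≡ m ∸ (l ∸ suc i)
      idx i i<l = begin-equality
        i ℕ+ (M ∸ l)                          ≡⟨ sym (m+n∸n≡m (i ℕ+ (M ∸ l)) (suc d)) ⟩
        i ℕ+ (M ∸ l) ℕ+ suc d ∸ suc d         ≡⟨ cong (_∸ suc d) (lem i (M ∸ l) d) ⟩
        (M ∸ l) ℕ+ (suc i ℕ+ d) ∸ suc d       ≡⟨ cong (λ z → (M ∸ l) ℕ+ z ∸ suc d) (m+[n∸m]≡n i<l) ⟩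
        (M ∸ l) ℕ+ l ∸ suc d                  ≡⟨ cong (_∸ suc d) (m∸n+n≡m l≤M) ⟩
        m ∸ d ∎
        where
        d = l ∸ suc i
        lem : ∀ i p d → i ℕ+ p ℕ+ suc d ≡ p ℕ+ (suc i ℕ+ d)
        lem = solve-∀

    preceded-const : ∀ b → b ≢ x → ∀ l → l < K → preceded b M u l ≡ false
    preceded-const b ne l l<K = preceded-≢ b M u l (λ e → ne (trans e (suffix-const l l<K)))

    preceded-const-n : ∀ b → b ≢ x → border (suc K) n u ≡ false → ∀ l → 1 ≤ l → l ≤ M → preceded b n u l ≡ false
    preceded-const-n b ne h (suc l) _ l≤M with <-≤-connex l K
    ... | inj₁ l<K = preceded-≢ b n u (suc l) (λ e → ne (trans e (suffix-const l l<K)))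
    ... | inj₂ K≤l = beyond-n-≢ b (inj₁ h) (suc l) (s≤s K≤l) l≤M

    -- A′ ends in K + 1 letters `x`, so `not x` precedes no border of A′ and no nonempty border of
    -- A. At most the last letter of A contributes, with weight 2.
    longer-run : u (m ∸ K) ≡ x → border (suc K) n u ≡ false → Worse (not x) m u
    longer-run e h = begin
      head b ℕ+ tail b ≡⟨ cong (_ℕ+ tail b) head0 ⟩
      tail b           ≤⟨ tail-bound b 0 (preceded-const-n b b≢x h) ⟩
      2                ≤⟨ *-monoʳ-≤ 2 (≤-trans (m^n>0 2 K) term) ⟩
      2 * wsum (preceded (not b) M u) m ≤⟨ m≤m+n _ _ ⟩
      2 * wsum (preceded (not b) M u) m ℕ+ wsum (preceded (not b) n u) M ∎
      where
      b = not x
      b≢x : b ≢ x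
      b≢x = not-≢ x ∘ sym
      van : ∀ l → l ≤ m → preceded b M u l ≡ false
      van l l≤m with <-≤-connex l K
      ... | inj₁ l<K = preceded-const b b≢x l l<K
      ... | inj₂ K≤l = beyond-≢ b (λ e′ → b≢x (trans e′ e)) l K≤l l≤m
      head0 : head b ≡ 0
      head0 rewrite van 0 z≤n | wsum-zero (preceded b M u) m (λ l _ l≤m → van l l≤m) = refl
      term : 2 ℕ^ K ≤ wsum (preceded (not b) M u) m
      term = go K refl
        where
        go : ∀ k → k ≡ K → 2 ℕ^ k ≤ wsum (preceded (not b) M u) m
        go zero refl = contradiction 0<K (n≮n 0)
        go (suc k) refl = wsum-term (preceded (not b) M u) K≤m (preceded-≡ (not b) M u K hK (trans (≢⇒not b≢x) (sym e)))

    -- A nonempty border of A of length at most K would end in `x`, unlike A; longer ones are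
    -- excluded by the choice of K and the last hypothesis. So A contributes nothing on the side of
    -- `x`.
    last-differs : u (m ∸ K) ≢ x → u M ≢ x → border (suc K) n u ≡ false → Worse x m u
    last-differs ne ne′ h = +-mono-≤ (head≤ x (ne ∘ sym)) (subst (_≤ wsum (preceded (not x) n u) M) (sym tail0) z≤n)
      where
      van : ∀ l → 1 ≤ l → l ≤ M → preceded x n u l ≡ false
      van (suc l) _ l≤M with <-≤-connex l K
      ... | inj₁ l<K = preceded-border x n u (suc l) (border-≢ M u l (λ e → ne′ (trans (sym e) (const l l<K))))
      ... | inj₂ K≤l = beyond-n-≢ x (inj₁ h) (suc l) (s≤s K≤l) l≤M
      tail0 : tail x ≡ 0
      tail0 rewrite preceded-≢ x n u 0 (ne′ ∘ sym) | wsum-zero (preceded x n u) M van = refl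

    -- `x` precedes the borders 1, ..., K - 1 of A′ and 1, ..., K of A, which yields 2(2^K - 2) +
    -- (2^(K+1) - 2) = 4 · 2^K - 6. On the other side stands at most the border K of A′, with 2 ·
    -- 2^K. The comparison holds exactly from K = 2 on; the failure at K = 1 is where special
    -- strings come from.
    last-agrees : 2 ≤ K → u M ≡ x → border (suc K) n u ≡ false → Worse (not x) m u
    last-agrees 2≤K e h = begin
      head b ℕ+ tail b    ≡⟨ cong₂ _ℕ+_ head0 tail0 ⟩
      2 * wsum (preceded b M u) m ℕ+ 0 ≡⟨ +-identityʳ _ ⟩
      2 * wsum (preceded b M u) m ≤⟨ *-monoʳ-≤ 2 (wsum-single (preceded b M u) m K only) ⟩
      2 * 2 ℕ^ K          ≤⟨ +-cancelʳ-≤ 6 _ _ sum6 ⟩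
      2 * wsum (preceded (not b) M u) m ℕ+ wsum (preceded (not b) n u) M ∎
      where
      b = not x
      b≢x : b ≢ x
      b≢x = not-≢ x ∘ sym
      only : ∀ l → 1 ≤ l → l ≢ K → l ≤ m → preceded b M u l ≡ false
      only l _ l≢K l≤m with <-≤-connex l K
      ... | inj₁ l<K = preceded-const b b≢x l l<K
      ... | inj₂ K≤l = preceded-border b M u l (beyond l (≤∧≢⇒< K≤l (l≢K ∘ sym)) l≤m)
      head0 : head b ≡ 2 * wsum (preceded b M u) m
      head0 rewrite preceded-const b b≢x 0 0<K = refl
      tail0 : tail b ≡ 0
      tail0 rewrite preceded-≢ b n u 0 (λ e′ → b≢x (trans e′ e))
        | wsum-zero (preceded b n u) M (preceded-const-n b b≢x h) = refl
      notb : not b ≡ x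
      notb = ≢⇒not b≢x
      full : 2 ℕ^ K ≤ wsum (preceded (not b) M u) m ℕ+ 2
      full = go K refl
        where
        go : ∀ k → k ≡ K → 2 ℕ^ k ≤ wsum (preceded (not b) M u) m ℕ+ 2
        go zero refl = contradiction 0<K (n≮n 0)
        go (suc k) refl = ≤-trans (wsum-full (preceded (not b) M u) k
            (λ l _ l≤k → preceded-≡ (not b) M u l (border-const l (s≤s l≤k)) (trans notb (sym (suffix-const l (s≤s l≤k))))))
          (+-monoˡ-≤ 2 (wsum-mono (preceded (not b) M u) (≤-trans (n≤1+n k) K≤m)))
      full-n : 2 ℕ^ suc K ≤ wsum (preceded (not b) n u) M ℕ+ 2
      full-n = ≤-trans (wsum-full (preceded (not b) n u) K all)
          (+-monoˡ-≤ 2 (wsum-mono (preceded (not b) n u) (m≤n⇒m≤1+n K≤m)))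
        where
        all : ∀ l → 1 ≤ l → l ≤ K → preceded (not b) n u l ≡ true
        all (suc l) _ l<K = preceded-≡ (not b) n u (suc l) (border-extend M u l (border-const l l<K) (trans (const l l<K) (sym e)))
          (trans notb (sym (suffix-const l l<K)))
      sum6 : 2 * 2 ℕ^ K ℕ+ 6 ≤ 2 * wsum (preceded (not b) M u) m ℕ+ wsum (preceded (not b) n u) M ℕ+ 6
      sum6 = begin
        2 * 2 ℕ^ K ℕ+ 6 ≤⟨ +-mono-≤ (*-monoʳ-≤ 2 full) (≤-trans (m≤m+n 6 2) (≤-trans (^-monoʳ-≤ 2 (s≤s 2≤K)) full-n)) ⟩
        2 * (w₁ ℕ+ 2) ℕ+ (w₂ ℕ+ 2) ≡⟨ lem w₁ w₂ ⟩
        2 * w₁ ℕ+ w₂ ℕ+ 6 ∎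
        where
        w₁ = wsum (preceded (not b) M u) m
        w₂ = wsum (preceded (not b) n u) M
        lem : ∀ a b → 2 * (a ℕ+ 2) ℕ+ (b ℕ+ 2) ≡ 2 * a ℕ+ b ℕ+ 6
        lem = solve-∀

-- The periods p and p + 1 of u force a shift by one on the border.
two-borders : ∀ {M u} k p → suc k ℕ+ p ≡ M → border (suc k) M u ≡ true → (k ≡ 0 ⊎ border k M u ≡ true) →
  ∀ i → i < suc k → u i ≡ u 0
two-borders k p e h h′ zero _ = refl
two-borders k p e h (inj₁ refl) (suc i) (s≤s ())
two-borders {M} {u} k p refl h (inj₂ h′) (suc i) (s≤s i<k) =
  trans (ends⇒ (suc k) p h (suc i) (s≤s i<k))
    (trans (cong u (sym (+-suc i p)))
      (trans (sym (ends⇒ k (suc p) (trans (cong (λ z → ends k z u u) (+-suc k p)) h′) i i<k))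
        (two-borders k p refl h (inj₂ h′) i (m≤n⇒m≤1+n i<k))))

Refuted : ℕ → Word → Set
Refuted m u = ∃[ b ] ((∃[ i ] (i < suc (suc m) × u i ≢ b)) × Worse b m u)

-- If the border K neither extends to A nor lacks a neighbour of length K - 1, two consecutive
-- periods make it a run of a single letter. Its left neighbour and the last letter of A then choose
-- the reply, and only K = 1 leaves a case without one.
special-or-refuted : ∀ m u → 1 ≤ m → (Special m u × u (suc m) ≡ u 0) ⊎ Refuted m u
special-or-refuted m u 1≤m with last-true (λ l → border l (suc m) u) m refl
... | K , K≤m , hK , beyond = go K refl
  where
  open Longest m u K K≤m hK beyond
  idx : m ∸ K < n
  idx = s≤s (≤-trans (m∸n≤m m K) (n≤1+n m))
  pre≢ : u (m ∸ K) ≢ not (u (m ∸ K))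
  pre≢ = not-≢ (u (m ∸ K))
  go : ∀ k → k ≡ K → (Special m u × u (suc m) ≡ u 0) ⊎ Refuted m u
  constant : ∀ k → suc k ≡ K → (k ≡ 0 ⊎ border k M u ≡ true) → border (suc K) n u ≡ false → (Special m u × u (suc m) ≡ u 0) ⊎ Refuted m u
  go k e with border (suc K) n u in eq
  ... | true = inj₂ (not (u (m ∸ K)) , (m ∸ K , idx , pre≢) , extends _ (pre≢ ∘ sym) eq)
  -- The last letters of A′ and of A both differ from the first letter, hence agree; the other
  -- letter precedes no border of either, not even the empty one.
  go zero refl | false = inj₂ (not (u M) , (M , ≤-refl , not-≢ (u M)) ,
      +-mono-≤ (head≤ b ne) (subst (_≤ wsum (preceded (not b) n u) M) (sym tail0) z≤n))
    where
    b = not (u M)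
    u0≢uM : u 0 ≢ u M
    u0≢uM e with () ← trans (sym eq) (border-extend M u 0 refl e)
    u0≢um : u 0 ≢ u m
    u0≢um e with () ← trans (sym (beyond 1 (s≤s z≤n) 1≤m)) (border-extend m u 0 refl e)
    ne : b ≢ u m
    ne e = u0≢um (trans (¬-not u0≢uM) e)
    tail0 : tail b ≡ 0
    tail0 rewrite preceded-≢ b n u 0 (not-≢ (u M) ∘ sym)
      | wsum-zero (preceded b n u) M (beyond-n-≢ b (inj₁ eq)) = refl
  go (suc zero) e | false = constant 0 e (inj₁ refl) eq
  go (suc (suc k)) e | false with border (suc k) M u in eq′
  ... | true = constant (suc k) e (inj₂ eq′) eq
  ... | false = inj₂ (not (u (m ∸ K)) , (m ∸ K , idx , pre≢) , no-second _ k (sym e) (pre≢ ∘ sym) eq eq′)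
  constant k refl h h′ with u (m ∸ K) ≟B u 0 | u M ≟B u 0
  ... | yes e | _ = inj₂ (not (u 0) , (0 , s≤s z≤n , not-≢ (u 0)) , longer-run e h′)
    where open Constant (s≤s z≤n) (two-borders k (M ∸ K) (m+[n∸m]≡n (m≤n⇒m≤1+n K≤m)) hK h)
  ... | no ne | no ne′ = inj₂ (u 0 , (m ∸ K , idx , ne) , last-differs ne ne′ h′)
    where open Constant (s≤s z≤n) (two-borders k (M ∸ K) (m+[n∸m]≡n (m≤n⇒m≤1+n K≤m)) hK h)
  constant zero refl h h′ | no ne | yes e = inj₁ (record
      -- If the first two letters agreed, the border 1 of A′ would extend to a border 2 of A.
      { start = λ e′ → contradiction (trans (sym (border-extend M u 1 hK (trans e′ (sym e)))) h′) λ ()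
      ; end = suffix-const 0 (s≤s z≤n)
      ; end′ = ne
      ; unbordered = beyond } , e)
    where
    open Constant (s≤s z≤n) (two-borders 0 (M ∸ K) (m+[n∸m]≡n (m≤n⇒m≤1+n K≤m)) hK h)
  constant (suc k) refl h h′ | no ne | yes e = inj₂ (not (u 0) , (0 , s≤s z≤n , not-≢ (u 0)) , last-agrees (s≤s (s≤s z≤n)) e h′)
    where open Constant (s≤s z≤n) (two-borders (suc k) (M ∸ K) (m+[n∸m]≡n (m≤n⇒m≤1+n K≤m)) hK h)

-- Odds against a special string

Differ : ℕ → Word → Word → Set
Differ n u v = ∃[ i ] (i < n × u i ≢ v i)

ends-differ : ∀ n {u v} → Differ n v u → ends n n v u ≡ false
ends-differ n {u} {v} (i , i<n , ne) with ends n n v u in eq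
... | true  = contradiction (ends-full n eq i i<n) ne
... | false = refl

differ-sym : ∀ {n u v} → Differ n u v → Differ n v u
differ-sym (i , i<n , ne) = i , i<n , ne ∘ sym

conway-self-≥ : ∀ m u → 2 ℕ^ suc m ≤ conway (suc m) u u
conway-self-≥ m u = ≤-trans (m≤n+m _ (wsum (λ l → border l (suc m) u) m)) (≤-reflexive (sym (conway-self m u)))

conway-differ-< : ∀ m {u v} → Differ (suc m) u v → conway (suc m) u v ℕ+ 2 ≤ 2 ℕ^ suc m
conway-differ-< m {u} {v} d rewrite conway-≢ m {u} {v} (ends-differ (suc m) (differ-sym d)) = wsum-upper _ m

conway-cong : ∀ n {u u′ v v′} → (∀ i → i < n → u i ≡ u′ i) → (∀ i → i < n → v i ≡ v′ i) → conway n u v ≡ conway n u′ v′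
conway-cong n hu hv = wsum-cong n (λ j _ j≤n → ends-cong j n (λ i i<j → hv i (<-≤-trans i<j j≤n)) hu)

-- The optimal odds x : y against A are (2Q + 1) : (Q + 1), where Q = 2^(n-2).
odds≥₁ : ∀ Q x y → x ≤ 4 * Q ℕ+ 2 → 2 * Q ℕ+ 2 ≤ y → x * (Q ℕ+ 1) ≤ y * (2 * Q ℕ+ 1)
odds≥₁ Q x y hx hy = begin
  x * (Q ℕ+ 1)                    ≤⟨ *-monoˡ-≤ (Q ℕ+ 1) hx ⟩
  (4 * Q ℕ+ 2) * (Q ℕ+ 1)         ≡⟨ lem Q ⟩
  (2 * Q ℕ+ 2) * (2 * Q ℕ+ 1)     ≤⟨ *-monoˡ-≤ (2 * Q ℕ+ 1) hy ⟩
  y * (2 * Q ℕ+ 1) ∎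
  where
  open ≤-Reasoning
  lem : ∀ Q → (4 * Q ℕ+ 2) * (Q ℕ+ 1) ≡ (2 * Q ℕ+ 2) * (2 * Q ℕ+ 1)
  lem = solve-∀

odds≥₂ : ∀ Q x y → x ℕ+ 4 ≤ 4 * Q → 2 * Q ≤ y → x * (Q ℕ+ 1) ≤ y * (2 * Q ℕ+ 1)
odds≥₂ Q x y hx hy = +-cancelʳ-≤ (4 * (Q ℕ+ 1)) _ _ (begin
  x * (Q ℕ+ 1) ℕ+ 4 * (Q ℕ+ 1)            ≡⟨ sym (*-distribʳ-+ (Q ℕ+ 1) x 4) ⟩
  (x ℕ+ 4) * (Q ℕ+ 1)                     ≤⟨ *-monoˡ-≤ (Q ℕ+ 1) hx ⟩
  4 * Q * (Q ℕ+ 1)                        ≤⟨ m≤m+n _ (2 * Q ℕ+ 4) ⟩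
  4 * Q * (Q ℕ+ 1) ℕ+ (2 * Q ℕ+ 4)        ≡⟨ lem Q ⟩
  2 * Q * (2 * Q ℕ+ 1) ℕ+ 4 * (Q ℕ+ 1)    ≤⟨ +-monoˡ-≤ (4 * (Q ℕ+ 1)) (*-monoˡ-≤ (2 * Q ℕ+ 1) hy) ⟩
  y * (2 * Q ℕ+ 1) ℕ+ 4 * (Q ℕ+ 1) ∎)
  where
  open ≤-Reasoning
  lem : ∀ Q → 4 * Q * (Q ℕ+ 1) ℕ+ (2 * Q ℕ+ 4) ≡ 2 * Q * (2 * Q ℕ+ 1) ℕ+ 4 * (Q ℕ+ 1)
  lem = solve-∀

odds≤ : ∀ Q x y → 4 * Q ℕ+ 2 ≤ x → y ≤ 2 * Q ℕ+ 2 → y * (2 * Q ℕ+ 1) ≤ x * (Q ℕ+ 1)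
odds≤ Q x y hx hy = begin
  y * (2 * Q ℕ+ 1)                ≤⟨ *-monoˡ-≤ (2 * Q ℕ+ 1) hy ⟩
  (2 * Q ℕ+ 2) * (2 * Q ℕ+ 1)     ≡⟨ lem Q ⟩
  (4 * Q ℕ+ 2) * (Q ℕ+ 1)         ≤⟨ *-monoˡ-≤ (Q ℕ+ 1) hx ⟩
  x * (Q ℕ+ 1) ∎
  where
  open ≤-Reasoning
  lem : ∀ Q → (2 * Q ℕ+ 2) * (2 * Q ℕ+ 1) ≡ (4 * Q ℕ+ 2) * (Q ℕ+ 1)
  lem = solve-∀

odds< : ∀ Q x y → 1 ≤ x → 2 * y ≤ x → y * (2 * Q ℕ+ 1) < x * (Q ℕ+ 1)
odds< Q x y 1≤x h = *-cancelˡ-< 2 _ _ (begin-strict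
  2 * (y * (2 * Q ℕ+ 1))   ≡⟨ sym (*-assoc 2 y _) ⟩
  2 * y * (2 * Q ℕ+ 1)     ≤⟨ *-monoˡ-≤ (2 * Q ℕ+ 1) h ⟩
  x * (2 * Q ℕ+ 1)         <⟨ m<m+n (x * (2 * Q ℕ+ 1)) 1≤x ⟩
  x * (2 * Q ℕ+ 1) ℕ+ x    ≡⟨ lem x Q ⟩
  2 * (x * (Q ℕ+ 1)) ∎)
  where
  open ≤-Reasoning
  lem : ∀ x Q → x * (2 * Q ℕ+ 1) ℕ+ x ≡ 2 * (x * (Q ℕ+ 1))
  lem = solve-∀

4*≡ : ∀ Q → 2 * (2 * Q) ≡ 4 * Q
4*≡ = solve-∀

-- x : y are the odds of B against A, for A = u and B = v.
module LeadBounds (m : ℕ) (u v : Word) {x y : ℕ}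
  (hx : conway (suc (suc m)) u u ≡ conway (suc (suc m)) u v ℕ+ x)
  (hy : conway (suc (suc m)) v v ≡ conway (suc (suc m)) v u ℕ+ y) where

  open ≤-Reasoning

  private
    M = suc m
    n = suc M
    Q = 2 ℕ^ m

  -- Subtraction-free interval arithmetic for x = AA - AB; the summand `c` is the part common to
  -- both estimates.
  x-upper : ∀ {a b c} → conway n u u ≤ a ℕ+ c → b ℕ+ c ≤ conway n u v → x ℕ+ b ≤ a
  x-upper {a} {b} {c} ha hb = +-cancelʳ-≤ c _ _ (begin
    x ℕ+ b ℕ+ c               ≡⟨ +-assoc x b c ⟩
    x ℕ+ (b ℕ+ c)             ≤⟨ +-monoʳ-≤ x hb ⟩
    x ℕ+ conway n u v         ≡⟨ +-comm x _ ⟩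
    conway n u v ℕ+ x         ≡⟨ sym hx ⟩
    conway n u u              ≤⟨ ha ⟩
    a ℕ+ c ∎)

  y-lower : ∀ {a b c} → a ℕ+ b ≤ conway n v v → conway n v u ≤ b ℕ+ c → a ≤ y ℕ+ c
  y-lower {a} {b} {c} ha hb = +-cancelʳ-≤ b _ _ (begin
    a ℕ+ b            ≤⟨ ha ⟩
    conway n v v      ≡⟨ hy ⟩
    conway n v u ℕ+ y ≤⟨ +-monoˡ-≤ y hb ⟩
    b ℕ+ c ℕ+ y       ≡⟨ lem b c y ⟩
    y ℕ+ c ℕ+ b ∎)
    where
    lem : ∀ b c y → b ℕ+ c ℕ+ y ≡ y ℕ+ c ℕ+ b
    lem = solve-∀

  x-positive : Differ n u v → 1 ≤ x
  x-positive d = +-cancelˡ-≤ (conway n u v) _ _ (begin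
    conway n u v ℕ+ 1 ≤⟨ +-monoʳ-≤ (conway n u v) (s≤s z≤n) ⟩
    conway n u v ℕ+ 2 ≤⟨ conway-differ-< M d ⟩
    2 ℕ^ n            ≤⟨ conway-self-≥ M u ⟩
    conway n u u      ≡⟨ hx ⟩
    conway n u v ℕ+ x ∎)

worse⇒odds< : ∀ {m u x y} b → (∃[ i ] (i < suc (suc m) × u i ≢ b)) → Worse b m u →
  conway (suc (suc m)) u u ≡ conway (suc (suc m)) u (b ▸ u) ℕ+ x →
  conway (suc (suc m)) (b ▸ u) (b ▸ u) ≡ conway (suc (suc m)) (b ▸ u) u ℕ+ y →
  Differ (suc (suc m)) u (b ▸ u) →
  y * (2 * 2 ℕ^ m ℕ+ 1) < x * (2 ℕ^ m ℕ+ 1)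
worse⇒odds< {m} {u} {x} {y} b ne worse hx hy d = odds< (2 ℕ^ m) x y (LeadBounds.x-positive m u (b ▸ u) hx hy d)
  (+-cancelʳ-≤ (c ℕ+ (2 * B ℕ+ 2 * P)) _ _ (begin
    2 * y ℕ+ (c ℕ+ (2 * B ℕ+ 2 * P)) ≡⟨ lem₁ y c B P ⟩
    2 * (B ℕ+ P ℕ+ y) ℕ+ c           ≡⟨ cong₂ (λ s t → 2 * s ℕ+ t) vv uv ⟩
    2 * (2 * (i₀ ℕ+ Bᵇ) ℕ+ 2 * P) ℕ+ 2 * (j₀ ℕ+ Aᵇ) ≡⟨ lem₂ i₀ Bᵇ P j₀ Aᵇ ⟩
    (4 * i₀ ℕ+ 2 * Bᵇ ℕ+ (2 * j₀ ℕ+ Aᵇ)) ℕ+ (2 * Bᵇ ℕ+ Aᵇ ℕ+ 4 * P) ≤⟨ +-monoˡ-≤ _ worse ⟩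
    (2 * B° ℕ+ A°) ℕ+ (2 * Bᵇ ℕ+ Aᵇ ℕ+ 4 * P) ≡⟨ lem₃ B° A° Bᵇ Aᵇ P ⟩
    (Aᵇ ℕ+ A°) ℕ+ 2 * P ℕ+ (2 * (Bᵇ ℕ+ B°) ℕ+ 2 * P) ≡⟨ cong₂ (λ s t → s ℕ+ 2 * P ℕ+ (2 * t ℕ+ 2 * P))
                                              (sym (wsum-split (λ l → border l n u) (λ l → u (n ∸ suc l)) b M))
                                              (sym (wsum-split (λ l → border l M u) (λ l → u (M ∸ suc l)) b m)) ⟩
    A ℕ+ 2 * P ℕ+ (2 * B ℕ+ 2 * P)   ≡⟨ cong (_ℕ+ (2 * B ℕ+ 2 * P)) (trans (sym (conway-self M u)) (trans hx (+-comm c x))) ⟩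
    x ℕ+ c ℕ+ (2 * B ℕ+ 2 * P)       ≡⟨ +-assoc x c _ ⟩
    x ℕ+ (c ℕ+ (2 * B ℕ+ 2 * P)) ∎))
  where
  open ≤-Reasoning
  M = suc m
  n = suc M
  P = 2 ℕ^ M
  c = conway n u (b ▸ u)
  A = wsum (λ l → border l n u) M
  B = wsum (λ l → border l M u) m
  Aᵇ = wsum (preceded b n u) M
  A° = wsum (preceded (not b) n u) M
  Bᵇ = wsum (preceded b M u) m
  B° = wsum (preceded (not b) M u) m
  i₀ = 𝟙 (preceded b M u 0)
  j₀ = 𝟙 (preceded b n u 0)
  vv : B ℕ+ P ℕ+ y ≡ 2 * (i₀ ℕ+ Bᵇ) ℕ+ 2 * P
  vv = trans (cong (_ℕ+ y) (sym (conway-▸ˡ m u b ne))) (trans (sym hy) (conway-▸▸ m u b))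
  uv : c ≡ 2 * (j₀ ℕ+ Aᵇ)
  uv = conway-▸ʳ M u b
  lem₁ : ∀ y c B P → 2 * y ℕ+ (c ℕ+ (2 * B ℕ+ 2 * P)) ≡ 2 * (B ℕ+ P ℕ+ y) ℕ+ c
  lem₁ = solve-∀
  lem₂ : ∀ i B P j A → 2 * (2 * (i ℕ+ B) ℕ+ 2 * P) ℕ+ 2 * (j ℕ+ A) ≡ (4 * i ℕ+ 2 * B ℕ+ (2 * j ℕ+ A)) ℕ+ (2 * B ℕ+ A ℕ+ 4 * P)
  lem₂ = solve-∀
  lem₃ : ∀ B₀ A₀ B A P → (2 * B₀ ℕ+ A₀) ℕ+ (2 * B ℕ+ A ℕ+ 4 * P) ≡ (A ℕ+ A₀) ℕ+ 2 * P ℕ+ (2 * (B ℕ+ B₀) ℕ+ 2 * P)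
  lem₃ = solve-∀

module _ {m : ℕ} {u : Word} (1≤m : 1 ≤ m) (sp : Special m u) (last : u (suc m) ≡ u 0) where

  open Framed sp
  open ≤-Reasoning hiding (start)

  private
    M = suc m
    n = suc M
    Q = 2 ℕ^ m

  border-1 : border 1 M u ≡ true
  border-1 = border-extend m u 0 refl (sym end)

  border-1-n : border 1 n u ≡ true
  border-1-n = border-extend M u 0 refl (sym last)

  no-border-n : ∀ l → 1 < l → l ≤ M → border l n u ≡ false
  no-border-n (suc (suc zero)) _ _ = border-≢ M u 1 (λ e → start (trans e last))
  no-border-n (suc zero) (s≤s ()) _
  no-border-n (suc (suc (suc l))) _ (s≤s l≤m) = border-shorten M u (suc (suc l)) (unbordered (suc (suc l)) (s≤s (s≤s z≤n)) l≤m)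

  wsum-border : wsum (λ l → border l M u) m ≡ 2
  wsum-border = ≤-antisym (+-cancelʳ-≤ 2 _ 2 (wsum-vanish _ m 1 unbordered)) (wsum-term (λ l → border l M u) 1≤m border-1)

  wsum-border-n : wsum (λ l → border l n u) M ≡ 2
  wsum-border-n = ≤-antisym (+-cancelʳ-≤ 2 _ 2 (wsum-vanish _ M 1 no-border-n)) (wsum-term (λ l → border l n u) {0} {M} (s≤s z≤n) border-1-n)

  conway-uu : conway n u u ≡ 4 * Q ℕ+ 2
  conway-uu = trans (conway-self M u) (trans (cong₂ _ℕ+_ wsum-border-n (4*≡ Q)) (+-comm 2 (4 * Q)))

  nonconstant : ∀ b → ∃[ i ] (i < n × u i ≢ b)
  nonconstant b with u 0 ≟B b
  ... | no ne = 0 , s≤s z≤n , ne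
  ... | yes refl = 1 , s≤s (s≤s z≤n) , start

  conway-▸u : ∀ b → conway n (b ▸ u) u ≡ 2 * Q ℕ+ 2
  conway-▸u b = trans (conway-▸ˡ m u b (nonconstant b)) (trans (cong (_ℕ+ 2 * Q) wsum-border) (+-comm 2 (2 * Q)))

  -- Unless B = bA′, the overlap of length n - 1 is missing from BA, so BA ≤ 2Q - 2 and y ≥ 2Q + 2.
  -- If B = bA′ with `b` ≢ `u 0`, then `b` precedes the border 1 of A′, which adds 4 to BB and again
  -- gives y ≥ 2Q + 2. If `b` ≡ `u 0`, only y ≥ 2Q is available, but overlaps of lengths 1 and 2
  -- give AB ≥ 6 and push x down to 4Q - 4.
  special-odds : ∀ {v x y} → Differ n u v → conway n u u ≡ conway n u v ℕ+ x → conway n v v ≡ conway n v u ℕ+ y →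
    x * (Q ℕ+ 1) ≤ y * (2 * Q ℕ+ 1)
  special-odds {v} {x} {y} d hx hy = split (ends M n u v) refl
   where
   split : ∀ e → ends M n u v ≡ e → x * (Q ℕ+ 1) ≤ y * (2 * Q ℕ+ 1)
   split false eq = odds≥₁ Q x y
      (≤-trans (m≤m+n x 0) (LeadBounds.x-upper m u v hx hy {b = 0} {c = 0} (≤-reflexive (trans conway-uu (sym (+-identityʳ _)))) z≤n))
      (≤-trans (LeadBounds.y-lower m u v hx hy {a = 2 * Q ℕ+ 2} {b = 2 * Q ∸ 2} {c = 0}
        (≤-trans (≤-reflexive (trans (+-assoc (2 * Q) 2 _) (cong (2 * Q ℕ+_) (trans (m+[n∸m]≡n 2≤) (sym (+-identityʳ _)))))) (conway-self-≥ M v))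
        (≤-trans vu (≤-reflexive (sym (+-identityʳ _))))) (≤-reflexive (+-identityʳ y)))
    where
    2≤ : 2 ≤ 2 * Q
    2≤ = *-monoʳ-≤ 2 (m^n>0 2 m)
    vu : conway n v u ≤ 2 * Q ∸ 2
    vu rewrite conway-≢ M {v} {u} (ends-differ n d) | eq | *-zeroʳ (2 ℕ^ M) | +-identityʳ (wsum (λ j → ends j n u v) m)
      = m+n≤o⇒m≤o∸n (wsum (λ j → ends j n u v) m) (wsum-upper (λ j → ends j n u v) m)
   split true eq = helper (v 0 ≟B u 0)
    where
    b = v 0
    v≡ : ∀ i → i < n → v i ≡ (b ▸ u) i
    v≡ zero _ = refl
    v≡ (suc i) (s≤s i<M) = sym (trans (ends⇒ M 1 (trans (cong (λ k → ends M k u v) (+-comm M 1)) eq) i i<M) (cong v (+-comm i 1)))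
    refl-on : ∀ i → i < n → u i ≡ u i
    refl-on i _ = refl
    vu : conway n v u ≡ 2 * Q ℕ+ 2
    vu = trans (conway-cong n v≡ refl-on) (conway-▸u b)
    vv : conway n v v ≡ 2 * (𝟙 (preceded b M u 0) ℕ+ wsum (preceded b M u) m) ℕ+ 2 * (2 * Q)
    vv = trans (conway-cong n v≡ v≡) (conway-▸▸ m u b)
    uv : conway n u v ≡ 2 * (𝟙 (preceded b n u 0) ℕ+ wsum (preceded b n u) M)
    uv = trans (conway-cong n refl-on v≡) (conway-▸ʳ M u b)
    helper : Dec (v 0 ≡ u 0) → x * (Q ℕ+ 1) ≤ y * (2 * Q ℕ+ 1)
    helper (no b≢) = odds≥₁ Q x y
        (≤-trans (m≤m+n x 0) (LeadBounds.x-upper m u v hx hy {b = 0} {c = 0} (≤-reflexive (trans conway-uu (sym (+-identityʳ _)))) z≤n))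
        (≤-trans (LeadBounds.y-lower m u v hx hy {a = 2 * Q ℕ+ 2} {b = 2 * Q ℕ+ 2} {c = 0} vv≥ (≤-reflexive (trans vu (sym (+-identityʳ _))))) (≤-reflexive (+-identityʳ y)))
      where
      term : 2 ≤ wsum (preceded b M u) m
      term = wsum-term (preceded b M u) 1≤m (preceded-≡ b M u 1 border-1 (trans (¬-not b≢) (sym (¬-not end′))))
      vv≥ : 2 * Q ℕ+ 2 ℕ+ (2 * Q ℕ+ 2) ≤ conway n v v
      vv≥ = begin
        2 * Q ℕ+ 2 ℕ+ (2 * Q ℕ+ 2) ≡⟨ lem Q ⟩
        2 * 2 ℕ+ 2 * (2 * Q)       ≤⟨ +-monoˡ-≤ (2 * (2 * Q)) (*-monoʳ-≤ 2 (≤-trans term (m≤n+m _ (𝟙 (preceded b M u 0))))) ⟩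
        2 * (𝟙 (preceded b M u 0) ℕ+ wsum (preceded b M u) m) ℕ+ 2 * (2 * Q) ≡⟨ sym vv ⟩
        conway n v v ∎
        where
        lem : ∀ Q → 2 * Q ℕ+ 2 ℕ+ (2 * Q ℕ+ 2) ≡ 2 * 2 ℕ+ 2 * (2 * Q)
        lem = solve-∀
    helper (yes b≡) = odds≥₂ Q x y
        (LeadBounds.x-upper m u v hx hy {a = 4 * Q} {b = 4} {c = 2} (≤-reflexive conway-uu) uv≥)
        (≤-trans (LeadBounds.y-lower m u v hx hy {a = 2 * Q} {b = 2 * Q ℕ+ 2} {c = 0} vv≥ (≤-reflexive (trans vu (sym (+-identityʳ _))))) (≤-reflexive (+-identityʳ y)))
      where
      uv≥ : 6 ≤ conway n u v
      uv≥ = begin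
        2 * (1 ℕ+ 2) ≤⟨ *-monoʳ-≤ 2 (+-mono-≤
            (≤-reflexive (cong 𝟙 (sym (preceded-≡ b n u 0 refl (trans b≡ (sym last))))))
            (wsum-term (preceded b n u) {0} {M} (s≤s z≤n) (preceded-≡ b n u 1 border-1-n (trans b≡ (sym end))))) ⟩
        2 * (𝟙 (preceded b n u 0) ℕ+ wsum (preceded b n u) M) ≡⟨ sym uv ⟩
        conway n u v ∎
      vv≥ : 2 * Q ℕ+ (2 * Q ℕ+ 2) ≤ conway n v v
      vv≥ = begin
        2 * Q ℕ+ (2 * Q ℕ+ 2)       ≡⟨ lem Q ⟩
        2 * (1 ℕ+ 0) ℕ+ 2 * (2 * Q) ≤⟨ +-monoˡ-≤ (2 * (2 * Q)) (*-monoʳ-≤ 2 (+-mono-≤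
            (≤-reflexive (cong 𝟙 (sym (preceded-≡ b M u 0 refl (trans b≡ (sym end)))))) z≤n)) ⟩
        2 * (𝟙 (preceded b M u 0) ℕ+ wsum (preceded b M u) m) ℕ+ 2 * (2 * Q) ≡⟨ sym vv ⟩
        conway n v v ∎
        where
        lem : ∀ Q → 2 * Q ℕ+ (2 * Q ℕ+ 2) ≡ 2 * (1 ℕ+ 0) ℕ+ 2 * (2 * Q)
        lem = solve-∀

  -- The borders 0 and 1 of A are both preceded by `u 0`, so AB = 0 for this reply and x takes its
  -- largest value 4Q + 2.
  special-tight : ∀ {x y} → conway n u u ≡ conway n u (not (u 0) ▸ u) ℕ+ x →
    conway n (not (u 0) ▸ u) (not (u 0) ▸ u) ≡ conway n (not (u 0) ▸ u) u ℕ+ y →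
    y * (2 * Q ℕ+ 1) ≤ x * (Q ℕ+ 1)
  special-tight {x} {y} hx hy = odds≤ Q x y
      (≤-reflexive (trans (sym conway-uu) (trans hx (cong (_ℕ+ x) uv))))
      (+-cancelˡ-≤ (2 * Q ℕ+ 2) _ _ (begin
        2 * Q ℕ+ 2 ℕ+ y             ≡⟨ cong (_ℕ+ y) (sym (conway-▸u b)) ⟩
        conway n (b ▸ u) u ℕ+ y     ≡⟨ sym hy ⟩
        conway n (b ▸ u) (b ▸ u)    ≡⟨ conway-▸▸ m u b ⟩
        2 * (𝟙 (preceded b M u 0) ℕ+ wsum (preceded b M u) m) ℕ+ 2 * (2 * Q)
                                    ≡⟨ cong (λ i → 2 * (𝟙 i ℕ+ wsum (preceded b M u) m) ℕ+ 2 * (2 * Q)) (preceded-≢ b M u 0 (λ e → b≢ (trans e end))) ⟩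
        2 * (wsum (preceded b M u) m) ℕ+ 2 * (2 * Q)
                                    ≤⟨ +-monoˡ-≤ (2 * (2 * Q)) (*-monoʳ-≤ 2 (+-cancelʳ-≤ 2 _ 2
                                         (wsum-vanish (preceded b M u) m 1 (λ l 1<l l≤m → preceded-border b M u l (unbordered l 1<l l≤m))))) ⟩
        2 * 2 ℕ+ 2 * (2 * Q)        ≡⟨ lem Q ⟩
        2 * Q ℕ+ 2 ℕ+ (2 * Q ℕ+ 2) ∎))
    where
    b = not (u 0)
    b≢ : b ≢ u 0
    b≢ = not-≢ (u 0) ∘ sym
    van : ∀ l → 1 ≤ l → l ≤ M → preceded b n u l ≡ false
    van (suc zero) _ _ = preceded-≢ b n u 1 (λ e → b≢ (trans e end))
    van (suc (suc l)) _ l≤M = preceded-border b n u (suc (suc l)) (no-border-n (suc (suc l)) (s≤s (s≤s z≤n)) l≤M)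
    uv : conway n u (b ▸ u) ≡ 0
    uv = trans (conway-▸ʳ M u b) (cong₂ (λ i w → 2 * (𝟙 i ℕ+ w)) (preceded-≢ b n u 0 (λ e → b≢ (trans e last))) (wsum-zero (preceded b n u) M van))
    lem : ∀ Q → 2 * 2 ℕ+ 2 * (2 * Q) ≡ 2 * Q ℕ+ 2 ℕ+ (2 * Q ℕ+ 2)
    lem = solve-∀

-- Counting strings

tab : ∀ n → Word → Vec Bool n
tab zero u = []
tab (suc n) u = u 0 ∷ tab n (u ∘ suc)

at-tab : ∀ n u i → i < n → at (tab n u) i ≡ u i
at-tab (suc n) u zero _ = refl
at-tab (suc n) u (suc i) (s≤s i<n) = at-tab n (u ∘ suc) i i<n

at-injective : ∀ {n} (A B : Vec Bool n) → (∀ i → i < n → at A i ≡ at B i) → A ≡ B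
at-injective [] [] h = refl
at-injective (a ∷ A) (b ∷ B) h = cong₂ _∷_ (h 0 (s≤s z≤n)) (at-injective A B (λ i i<n → h (suc i) (s≤s i<n)))

at-++ˡ : ∀ {a b} (A : Vec Bool a) (B : Vec Bool b) i → i < a → at (A ++ᵥ B) i ≡ at A i
at-++ˡ (x ∷ A) B zero _ = refl
at-++ˡ (x ∷ A) B (suc i) (s≤s i<a) = at-++ˡ A B i i<a

at-++ʳ : ∀ {a b} (A : Vec Bool a) (B : Vec Bool b) i → at (A ++ᵥ B) (a ℕ+ i) ≡ at B i
at-++ʳ [] B i = refl
at-++ʳ (x ∷ A) B i = at-++ʳ A B i

Σ⟨_⟩ : ∀ n → (Vec Bool n → ℕ) → ℕ
Σ⟨ zero ⟩ f = f []
Σ⟨ suc n ⟩ f = Σ⟨ n ⟩ (λ v → f (true ∷ v)) ℕ+ Σ⟨ n ⟩ (λ v → f (false ∷ v))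

Σ-cong : ∀ n {f g : Vec Bool n → ℕ} → (∀ v → f v ≡ g v) → Σ⟨ n ⟩ f ≡ Σ⟨ n ⟩ g
Σ-cong zero h = h []
Σ-cong (suc n) h = cong₂ _ℕ+_ (Σ-cong n (λ v → h (true ∷ v))) (Σ-cong n (λ v → h (false ∷ v)))

Σ-++ : ∀ a b (f : Vec Bool (a ℕ+ b) → ℕ) → Σ⟨ a ℕ+ b ⟩ f ≡ Σ⟨ a ⟩ λ v → Σ⟨ b ⟩ λ w → f (v ++ᵥ w)
Σ-++ zero b f = refl
Σ-++ (suc a) b f = cong₂ _ℕ+_ (Σ-++ a b (λ v → f (true ∷ v))) (Σ-++ a b (λ v → f (false ∷ v)))

Σ-const : ∀ n c → Σ⟨ n ⟩ (λ _ → c) ≡ 2 ℕ^ n * c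
Σ-const zero c = sym (+-identityʳ c)
Σ-const (suc n) c rewrite Σ-const n c = lem (2 ℕ^ n) c
  where
  lem : ∀ p c → p * c ℕ+ p * c ≡ 2 * p * c
  lem = solve-∀

Σ-+ : ∀ n (f g : Vec Bool n → ℕ) → Σ⟨ n ⟩ (λ v → f v ℕ+ g v) ≡ Σ⟨ n ⟩ f ℕ+ Σ⟨ n ⟩ g
Σ-+ zero f g = refl
Σ-+ (suc n) f g = trans (cong₂ _ℕ+_ (Σ-+ n (λ v → f (true ∷ v)) (λ v → g (true ∷ v))) (Σ-+ n (λ v → f (false ∷ v)) (λ v → g (false ∷ v))))
  (lem (Σ⟨ n ⟩ (λ v → f (true ∷ v))) _ _ _)
  where
  lem : ∀ a b c d → a ℕ+ b ℕ+ (c ℕ+ d) ≡ a ℕ+ c ℕ+ (b ℕ+ d)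
  lem = solve-∀

Σ-* : ∀ n c (f : Vec Bool n → ℕ) → Σ⟨ n ⟩ (λ v → c * f v) ≡ c * Σ⟨ n ⟩ f
Σ-* zero c f = refl
Σ-* (suc n) c f = trans (cong₂ _ℕ+_ (Σ-* n c (λ v → f (true ∷ v))) (Σ-* n c (λ v → f (false ∷ v)))) (sym (*-distribˡ-+ c (Σ⟨ n ⟩ (λ v → f (true ∷ v))) _))

Σ-zero : ∀ n {f : Vec Bool n → ℕ} → (∀ v → f v ≡ 0) → Σ⟨ n ⟩ f ≡ 0
Σ-zero n h = trans (Σ-cong n h) (trans (Σ-const n 0) (*-zeroʳ (2 ℕ^ n)))

Σ-single : ∀ {n} (v₀ : Vec Bool n) {f : Vec Bool n → ℕ} → (∀ v → v ≢ v₀ → f v ≡ 0) → Σ⟨ n ⟩ f ≡ f v₀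
Σ-single [] h = refl
Σ-single {suc n} (true ∷ v₀) {f} h = trans (cong₂ _ℕ+_ (Σ-single v₀ (λ v ne → h (true ∷ v) (ne ∘ ∷-injectiveʳ))) (Σ-zero n (λ v → h (false ∷ v) λ ()))) (+-identityʳ _)
Σ-single {suc n} (false ∷ v₀) {f} h = cong₂ _ℕ+_ (Σ-zero n (λ v → h (true ∷ v) λ ())) (Σ-single v₀ (λ v ne → h (false ∷ v) (ne ∘ ∷-injectiveʳ)))

[_]? : ∀ {P : Set} → Dec P → ℕ
[ p ]? = 𝟙 (does p)

[]?-⇔ : ∀ {P Q : Set} (p : Dec P) (q : Dec Q) → (P → Q) → (Q → P) → [ p ]? ≡ [ q ]?
[]?-⇔ (yes p) q f g = cong 𝟙 (sym (dec-true q (f p)))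
[]?-⇔ (no ¬p) q f g = cong 𝟙 (sym (dec-false q (¬p ∘ g)))

[]?-no : ∀ {P : Set} (p : Dec P) → ¬ P → [ p ]? ≡ 0
[]?-no p ¬p = cong 𝟙 (dec-false p ¬p)

_≟ᵥ_ : ∀ {n} (v w : Vec Bool n) → Dec (v ≡ w)
_≟ᵥ_ = ≡-dec _≟B_

_∈?_ : ∀ {n} (v : Vec Bool n) l → Dec (v ∈ l)
v ∈? [] = no λ ()
v ∈? (x ∷ l) with v ≟ᵥ x | v ∈? l
... | yes e | _      = yes (here e)
... | no _  | yes e  = yes (there e)
... | no ne | no ne′ = no λ where
  (here e)  → ne e
  (there e) → ne′ e

Σ-unique : ∀ {n} (l : List (Vec Bool n)) → Unique l → Σ⟨ n ⟩ (λ v → [ v ∈? l ]?) ≡ length l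
Σ-unique {n} [] _ = Σ-zero n (λ _ → refl)
Σ-unique {n} (x ∷ l) (x∉l ∷ ul) = begin
  Σ⟨ n ⟩ (λ v → [ v ∈? (x ∷ l) ]?)              ≡⟨ Σ-cong n split ⟩
  Σ⟨ n ⟩ (λ v → [ v ≟ᵥ x ]? ℕ+ [ v ∈? l ]?)     ≡⟨ Σ-+ n _ _ ⟩
  Σ⟨ n ⟩ (λ v → [ v ≟ᵥ x ]?) ℕ+ Σ⟨ n ⟩ (λ v → [ v ∈? l ]?)
     ≡⟨ cong₂ _ℕ+_ (trans (Σ-single x (λ v → []?-no (v ≟ᵥ x))) (cong 𝟙 (dec-true (x ≟ᵥ x) refl))) (Σ-unique l ul) ⟩
  suc (length l) ∎
  where
  open ≡-Reasoning
  split : ∀ v → [ v ∈? (x ∷ l) ]? ≡ [ v ≟ᵥ x ]? ℕ+ [ v ∈? l ]?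
  split v with v ≟ᵥ x | v ∈? l
  ... | yes refl | yes v∈l = contradiction refl (All.lookup x∉l v∈l)
  ... | yes _    | no _    = refl
  ... | no _     | yes _   = refl
  ... | no _     | no _    = refl

count-Σ : ∀ {n P k} (P? : ∀ (v : Str n) → Dec (P v)) → Count P k → k ≡ Σ⟨ n ⟩ (λ v → [ P? v ]?)
count-Σ {n} P? (l , ul , iff , len) = trans (sym len) (trans (sym (Σ-unique l ul))
  (Σ-cong n (λ v → []?-⇔ (v ∈? l) (P? v) (Equivalence.to (iff v)) (Equivalence.from (iff v)))))

-- Framed words and the reduction to short borders

framed? : ∀ h m u → Dec (Framed h m u)
framed? h m u = map′ (λ (s , e , e′ , ub) → record { start = s ; end = e ; end′ = e′ ; unbordered = λ l 2≤l l≤h → ub (s≤s l≤h) 2≤l })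
    (λ fr → let open Framed fr in start , end , end′ , λ {l} l<sh 2≤l → unbordered l 2≤l (s≤s⁻¹ l<sh))
    (¬? (u 1 ≟B u 0) ×-dec (u m ≟B u 0) ×-dec ¬? (u (m ∸ 1) ≟B u 0) ×-dec allUpTo? (λ l → 2 ≤? l →-dec (border l (suc m) u ≟B false)) (suc h))

framed-cong : ∀ {h m u v} → h ≤ suc m → 1 ≤ m → (∀ i → i < suc m → u i ≡ v i) → Framed h m u → Framed h m v
framed-cong {h} {m} {u} {v} h≤ 1≤m eq sp = record
  { start = λ e → start (trans (eq 1 (s≤s 1≤m)) (trans e (sym (eq 0 (s≤s z≤n)))))
  ; end = trans (sym (eq m ≤-refl)) (trans end (eq 0 (s≤s z≤n)))
  ; end′ = λ e → end′ (trans (eq (m ∸ 1) (s≤s (m∸n≤m m 1))) (trans e (sym (eq 0 (s≤s z≤n)))))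
  ; unbordered = λ l 2≤l l≤h → trans (sym (ends-cong l (suc m) (λ i i<l → eq i (<-≤-trans i<l (≤-trans l≤h h≤))) eq)) (unbordered l 2≤l l≤h) }
  where open Framed sp

double-period : ∀ a p u → border (a ℕ+ p) (a ℕ+ p ℕ+ p) u ≡ true → border a (a ℕ+ p ℕ+ p) u ≡ true
double-period a p u h = trans (cong (λ k → border a k u) (+-assoc a p p)) (ends⇐ a (p ℕ+ p) λ i i<a →
  trans (per i (<-≤-trans i<a (m≤m+n a p))) (trans (per (i ℕ+ p) (+-monoˡ-< p i<a)) (cong u (+-assoc i p p))))
  where
  per : ∀ i → i < a ℕ+ p → u i ≡ u (i ℕ+ p)
  per = ends⇒ (a ℕ+ p) p h

-- A border of length l > h overlaps itself in at least 2 letters; the overlap is a shorter border.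
-- The fuel f bounds l.
short-borders : ∀ {h m u} → suc m ≤ 2 * h → (∀ l → 2 ≤ l → l ≤ h → border l (suc m) u ≡ false) →
  ∀ f l → l ≤ f → 2 ≤ l → l ≤ m → border l (suc m) u ≡ false
short-borders {h} {m} {u} le none zero l l≤f 2≤l l≤m = contradiction (≤-trans 2≤l l≤f) λ ()
short-borders {h} {m} {u} le none (suc f) l l≤f 2≤l l≤m with l ≤? h
... | yes l≤h = none l 2≤l l≤h
... | no l≰h with border l (suc m) u in eq
...   | false = refl
...   | true = trans (sym (trans (cong (λ k → border a k u) N≡) (double-period a p u (subst₂ (λ i k → border i k u ≡ true) l≡ N≡ eq))))
                (short-borders le none f a (s≤s⁻¹ (≤-trans l≥ l≤f)) 2≤a (≤-trans (≤-trans (n≤1+n a) l≥) l≤m))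
  where
  p = suc m ∸ l
  1≤p : 1 ≤ p
  1≤p = m<n⇒0<n∸m (s≤s l≤m)
  p+l : p ℕ+ l ≡ suc m
  p+l = m∸n+n≡m (m≤n⇒m≤1+n l≤m)
  h<l : h < l
  h<l = ≰⇒> l≰h
  p+2≤l : p ℕ+ 2 ≤ l
  p+2≤l = +-cancelʳ-≤ l _ _ (begin
    p ℕ+ 2 ℕ+ l   ≡⟨ lem p l ⟩
    p ℕ+ l ℕ+ 2   ≡⟨ cong (_ℕ+ 2) p+l ⟩
    suc m ℕ+ 2    ≤⟨ +-monoˡ-≤ 2 le ⟩
    2 * h ℕ+ 2    ≡⟨ lem′ h ⟩
    2 * suc h     ≤⟨ *-monoʳ-≤ 2 h<l ⟩
    2 * l         ≡⟨ cong (l ℕ+_) (+-identityʳ l) ⟩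
    l ℕ+ l ∎)
    where
    open ≤-Reasoning
    lem : ∀ p l → p ℕ+ 2 ℕ+ l ≡ p ℕ+ l ℕ+ 2
    lem = solve-∀
    lem′ : ∀ h → 2 * h ℕ+ 2 ≡ 2 * suc h
    lem′ = solve-∀
  a = l ∸ p
  2≤a : 2 ≤ a
  2≤a = m+n≤o⇒m≤o∸n 2 (≤-trans (≤-reflexive (+-comm 2 p)) p+2≤l)
  l≡ : l ≡ a ℕ+ p
  l≡ = sym (m∸n+n≡m (≤-trans (m≤m+n p 2) p+2≤l))
  N≡ : suc m ≡ a ℕ+ p ℕ+ p
  N≡ = trans (sym p+l) (trans (+-comm p l) (cong (_ℕ+ p) l≡))
  l≥ : suc a ≤ l
  l≥ = ≤-trans (≤-reflexive (+-comm 1 a)) (≤-trans (+-monoʳ-≤ a 1≤p) (≤-reflexive (sym l≡)))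

framed⇒special : ∀ {h m u} → suc m ≤ 2 * h → Framed h m u → Special m u
framed⇒special {h} {m} le fr = record { Framed fr ; unbordered = λ l 2≤l l≤m → short-borders le (Framed.unbordered fr) l l ≤-refl 2≤l l≤m }

framed-mono : ∀ {h h′ m u} → h ≤ h′ → Framed h′ m u → Framed h m u
framed-mono le fr = record { Framed fr ; unbordered = λ l 2≤l l≤h → Framed.unbordered fr l 2≤l (≤-trans l≤h le) }

ends-offset : ∀ l c k v u → l ≤ k → ends l (c ℕ+ k) v u ≡ ends l k v (λ i → u (c ℕ+ i))
ends-offset zero c k v u _ = refl
ends-offset (suc l) c (suc k) v u (s≤s l≤k) rewrite +-suc c k =
  cong (does (v l ≟B u (c ℕ+ k)) ∧_) (ends-offset l c k v u l≤k)

-- Optimal strings are the special ones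

≢⇒differ : ∀ {n} (A B : Vec Bool n) → A ≢ B → Differ n (at A) (at B)
≢⇒differ [] [] ne = contradiction refl ne
≢⇒differ (a ∷ A) (b ∷ B) ne with a ≟B b
... | no a≢b = 0 , s≤s z≤n , a≢b
... | yes refl with ≢⇒differ A B (ne ∘ cong (a ∷_))
...   | i , i<n , d = suc i , s≤s i<n , d

-- The odds of B against A are lead A B : lead B A.
lead : ∀ {n} → Str n → Str n → ℕ
lead {n} A B = conway n (at A) (at A) ∸ conway n (at A) (at B)

lead-≡ : ∀ {m} (A B : Str (suc m)) → A ≢ B → conway (suc m) (at A) (at A) ≡ conway (suc m) (at A) (at B) ℕ+ lead A B
lead-≡ {m} A B ne = sym (m+[n∸m]≡n (≤-trans (≤-trans (m≤m+n _ 2) (conway-differ-< m (≢⇒differ A B ne))) (conway-self-≥ m (at A))))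

lead-positive : ∀ {m} (A B : Str (suc m)) → A ≢ B → 1 ≤ lead A B
lead-positive {m} A B ne = m<n⇒0<n∸m (<-≤-trans (≤-trans (≤-trans (m≤m+n _ 1) (≤-reflexive (lem (conway (suc m) (at A) (at B))))) (conway-differ-< m (≢⇒differ A B ne))) (conway-self-≥ m (at A)))
  where
  lem : ∀ c → suc c ℕ+ 1 ≡ c ℕ+ 2
  lem = solve-∀

module _ {m : ℕ} {A B A′ B′ : Str (suc m)} (A≢B : A ≢ B) (A′≢B′ : A′ ≢ B′) where

  private
    x  = lead A B
    y  = lead B A
    x′ = lead A′ B′
    y′ = lead B′ A′

    module O  = Race.Odds (suc m) (at A) (at B) x y (lead-≡ A B A≢B) (lead-≡ B A (A≢B ∘ sym))
    module O′ = Race.Odds (suc m) (at A′) (at B′) x′ y′ (lead-≡ A′ B′ A′≢B′) (lead-≡ B′ A′ (A′≢B′ ∘ sym))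

    upper : ∀ N → (x ℕ+ y) * W N A B ≤ 2 ℕ^ N * y
    upper N rewrite W≡wins N A B = O.odds-upper N

    approx′ : ∀ e → ∃[ M ] 2 ℕ^ M * y′ * 2 ℕ^ e < (x′ ℕ+ y′) * W M A′ B′ * 2 ℕ^ e ℕ+ 2 ℕ^ M
    approx′ e with O′.odds-approx e
    ... | M , lt = M , subst (λ w → 2 ℕ^ M * y′ * 2 ℕ^ e < (x′ ℕ+ y′) * w * 2 ℕ^ e ℕ+ 2 ℕ^ M) (sym (W≡wins M A′ B′)) lt

    T  = x ℕ+ y
    T′ = x′ ℕ+ y′

    instance
      T-nonZero : NonZero T
      T-nonZero = >-nonZero (≤-trans (lead-positive A B A≢B) (m≤m+n x y))
      T′-nonZero : NonZero T′
      T′-nonZero = >-nonZero (≤-trans (lead-positive A′ B′ A′≢B′) (m≤m+n x′ y′))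

  open ≤-Reasoning

  -- The limits are y/(x + y) and y′/(x′ + y′); cross-multiplied, both sides contain y y′, which
  -- cancels. The first is never exceeded at any N, so only the second has to be approximated.
  probLe-intro : y * x′ ≤ y′ * x → ProbLe A B A′ B′
  probLe-intro le N e with approx′ e
  ... | M , lt = M , subst₂ (λ a b → W N A B * a < W M A′ B′ * b ℕ+ 2 ℕ^ (N ℕ+ M)) (sym (^-distribˡ-+-* 2 M e)) (sym (^-distribˡ-+-* 2 N e))
        (subst (λ c → w * (PM * E) < w′ * (PN * E) ℕ+ c) (sym (^-distribˡ-+-* 2 N M))
        (*-cancelˡ-< (T * T′) _ _ (begin-strict
    T * T′ * (w * (PM * E))            ≡⟨ lem₁ T T′ w PM E ⟩
    T * w * (T′ * PM * E)              ≤⟨ *-monoˡ-≤ (T′ * PM * E) (upper N) ⟩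
    PN * y * (T′ * PM * E)             ≡⟨ lem₂ PN y x′ y′ PM E ⟩
    PN * PM * E * (y * x′ ℕ+ y * y′)   ≤⟨ *-monoʳ-≤ (PN * PM * E) (+-monoˡ-≤ (y * y′) le) ⟩
    PN * PM * E * (y′ * x ℕ+ y * y′)   ≡⟨ lem₃ PN PM E y′ x y ⟩
    T * PN * (PM * y′ * E)             <⟨ *-monoʳ-< (T * PN) {{m*n≢0 T PN {{T-nonZero}} {{m^n≢0 2 N}}}} lt ⟩
    T * PN * (T′ * w′ * E ℕ+ PM)       ≡⟨ lem₄ T PN T′ w′ E PM ⟩
    T * T′ * (w′ * (PN * E)) ℕ+ T * (PN * PM) ≤⟨ +-monoʳ-≤ (T * T′ * (w′ * (PN * E))) (*-monoˡ-≤ (PN * PM) (m≤m*n T T′)) ⟩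
    T * T′ * (w′ * (PN * E)) ℕ+ T * T′ * (PN * PM) ≡⟨ sym (*-distribˡ-+ (T * T′) (w′ * (PN * E)) (PN * PM)) ⟩
    T * T′ * (w′ * (PN * E) ℕ+ PN * PM) ∎)))
    where
    E = 2 ℕ^ e
    PM = 2 ℕ^ M
    PN = 2 ℕ^ N
    w = W N A B
    w′ = W M A′ B′
    lem₁ : ∀ T T′ w P E → T * T′ * (w * (P * E)) ≡ T * w * (T′ * P * E)
    lem₁ = solve-∀
    lem₂ : ∀ PN y x′ y′ PM E → PN * y * ((x′ ℕ+ y′) * PM * E) ≡ PN * PM * E * (y * x′ ℕ+ y * y′)
    lem₂ = solve-∀
    lem₃ : ∀ PN PM E y′ x y → PN * PM * E * (y′ * x ℕ+ y * y′) ≡ (x ℕ+ y) * PN * (PM * y′ * E)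
    lem₃ = solve-∀
    lem₄ : ∀ T PN T′ w E PM → T * PN * (T′ * w * E ℕ+ PM) ≡ T * T′ * (w * (PN * E)) ℕ+ T * (PN * PM)
    lem₄ = solve-∀

  probLe-elim : ProbLe A′ B′ A B → y′ * x ≤ y * x′
  probLe-elim le = ≮⇒≥ λ gt → impossible gt (approx′ e)
    where
    -- A violation is by at least 1 and is magnified to 2^e, while the slack of `ProbLe` costs
    -- `T * T′` and that of `approx′` costs `T`. This choice makes 2^e exceed their sum.
    e = T * T′ ℕ+ T
    E = 2 ℕ^ e
    e<2^e : ∀ k → k < 2 ℕ^ k
    e<2^e zero = s≤s z≤n
    e<2^e (suc k) = ≤-trans (+-mono-≤ (m^n>0 2 k) (e<2^e k)) (≤-reflexive (cong (2 ℕ^ k ℕ+_) (sym (+-identityʳ (2 ℕ^ k)))))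
    lem₂ : ∀ P E x y y′ → P * (E * (y′ * x ℕ+ y * y′)) ≡ (x ℕ+ y) * (P * y′ * E)
    lem₂ = solve-∀
    impossible : y * x′ < y′ * x → ∃[ N ] 2 ℕ^ N * y′ * E < T′ * W N A′ B′ * E ℕ+ 2 ℕ^ N → ⊥
    impossible gt (N , lt) with le N e
    ... | M , lt′ = <⇒≱ (e<2^e e) (+-cancelˡ-≤ (E * (y * x′ ℕ+ y * y′)) _ _ (*-cancelˡ-≤ PN {{m^n≢0 2 N}} (begin
        PN * (E * (y * x′ ℕ+ y * y′) ℕ+ E)         ≡⟨ lem₃ PN E (y * x′) (y * y′) ⟩
        PN * (E * (suc (y * x′) ℕ+ y * y′))        ≤⟨ *-monoʳ-≤ PN (*-monoʳ-≤ E (+-monoˡ-≤ (y * y′) gt)) ⟩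
        PN * (E * (y′ * x ℕ+ y * y′))              ≡⟨ lem₂ PN E x y y′ ⟩
        T * (PN * y′ * E)                          ≤⟨ *-monoʳ-≤ T (<⇒≤ lt) ⟩
        T * (T′ * w * E ℕ+ PN)                     ≡⟨ lem₄ T T′ w E PN ⟩
        T * T′ * (w * E) ℕ+ T * PN                 ≤⟨ +-monoˡ-≤ (T * PN) step ⟩
        PN * (E * (y * x′ ℕ+ y * y′)) ℕ+ T * T′ * PN ℕ+ T * PN ≡⟨ lem₅ PN (E * (y * x′ ℕ+ y * y′)) (T * T′) T ⟩
        PN * (E * (y * x′ ℕ+ y * y′) ℕ+ e) ∎)))
      where
      PN = 2 ℕ^ N
      PM = 2 ℕ^ M
      w = W N A′ B′
      w₁ = W M A B
      lem₃ : ∀ P E a b → P * (E * (a ℕ+ b) ℕ+ E) ≡ P * (E * (suc a ℕ+ b))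
      lem₃ = solve-∀
      lem₄ : ∀ T T′ w E P → T * (T′ * w * E ℕ+ P) ≡ T * T′ * (w * E) ℕ+ T * P
      lem₄ = solve-∀
      lem₅ : ∀ P a b T → P * a ℕ+ b * P ℕ+ T * P ≡ P * (a ℕ+ (b ℕ+ T))
      lem₅ = solve-∀
      lem₆ : ∀ PM T T′ w E → PM * (T * T′ * (w * E)) ≡ T * T′ * (w * (PM * E))
      lem₆ = solve-∀
      lem₇ : ∀ T T′ w PN E PM → T * T′ * (w * (PN * E) ℕ+ PN * PM) ≡ T * w * (T′ * (PN * E)) ℕ+ T * T′ * (PN * PM)
      lem₇ = solve-∀
      lem₈ : ∀ PM y x′ y′ PN E TT → PM * y * ((x′ ℕ+ y′) * (PN * E)) ℕ+ TT * (PN * PM) ≡ PM * (PN * (E * (y * x′ ℕ+ y * y′)) ℕ+ TT * PN)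
      lem₈ = solve-∀
      lt″ : w * (PM * E) < w₁ * (PN * E) ℕ+ PN * PM
      lt″ = subst₂ _<_ (cong (w *_) (^-distribˡ-+-* 2 M e)) (cong₂ (λ a b → w₁ * a ℕ+ b) (^-distribˡ-+-* 2 N e) (^-distribˡ-+-* 2 N M)) lt′
      step : T * T′ * (w * E) ≤ PN * (E * (y * x′ ℕ+ y * y′)) ℕ+ T * T′ * PN
      step = *-cancelˡ-≤ PM {{m^n≢0 2 M}} (begin
        PM * (T * T′ * (w * E))                    ≡⟨ lem₆ PM T T′ w E ⟩
        T * T′ * (w * (PM * E))                    ≤⟨ *-monoʳ-≤ (T * T′) (<⇒≤ lt″) ⟩
        T * T′ * (w₁ * (PN * E) ℕ+ PN * PM)        ≡⟨ lem₇ T T′ w₁ PN E PM ⟩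
        T * w₁ * (T′ * (PN * E)) ℕ+ T * T′ * (PN * PM) ≤⟨ +-monoˡ-≤ _ (*-monoˡ-≤ (T′ * (PN * E)) (upper M)) ⟩
        PM * y * (T′ * (PN * E)) ℕ+ T * T′ * (PN * PM) ≡⟨ lem₈ PM y x′ y′ PN E (T * T′) ⟩
        PM * (PN * (E * (y * x′ ℕ+ y * y′)) ℕ+ T * T′ * PN) ∎)

SpecialStr : ∀ m → Str (suc (suc m)) → Set
SpecialStr m A = Special m (at A) × at A (suc m) ≡ at A 0

-- The string H T...T H H, with m - 1 letters T: a concrete special string for the others to be
-- measured against.
witness : ℕ → Word
witness m zero = true
witness m (suc i) = does (m ≤? suc i)

witness-special : ∀ m → 2 ≤ m → Special m (witness m)
witness-special (suc m) (s≤s 1≤m) = record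
  { start = λ e → contradiction (trans (sym e) (dec-false (suc m ≤? 1) (<⇒≱ (s≤s 1≤m)))) λ ()
  ; end = dec-true (suc m ≤? suc m) ≤-refl
  ; end′ = end′ m 1≤m
  ; unbordered = unb }
  where
  end′ : ∀ k → 1 ≤ k → witness (suc k) k ≢ true
  end′ (suc k) _ e = contradiction (trans (sym e) (dec-false (suc (suc k) ≤? suc k) (n≮n (suc k)))) λ ()
  unb : ∀ l → 2 ≤ l → l ≤ suc m → border l (suc (suc m)) (witness (suc m)) ≡ false
  unb l 2≤l l≤m with border l (suc (suc m)) (witness (suc m)) in eq
  ... | false = refl
  ... | true = contradiction (trans (ends⇒ l (suc p) (trans (cong (λ k → ends l k (witness (suc m)) (witness (suc m))) idx) eq) 0 (≤-trans (s≤s z≤n) 2≤l))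
                 (dec-false (suc m ≤? suc p) (<⇒≱ (s≤s p<m)))) λ ()
    where
    p = suc m ∸ l
    idx : l ℕ+ suc p ≡ suc (suc m)
    idx = trans (+-suc l p) (cong suc (m+[n∸m]≡n l≤m))
    p<m : p < m
    p<m = ≤-trans (∸-monoʳ-< {suc m} {l} {1} 2≤l l≤m) ≤-refl

specialStr : ∀ m → 2 ≤ m → ∃[ A ] SpecialStr m A
specialStr m 2≤m = A , framed-cong (n≤1+n m) (≤-trans (s≤s z≤n) 2≤m) (λ i i≤m → sym (at-A i (m≤n⇒m≤1+n i≤m))) (witness-special m 2≤m)
    , trans (at-A (suc m) ≤-refl) (dec-true (m ≤? suc m) (n≤1+n m))
  where
  A = tab (suc (suc m)) (witness m)
  at-A : ∀ i → i < suc (suc m) → at A i ≡ witness m i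
  at-A = at-tab (suc (suc m)) (witness m)

module _ {m : ℕ} (1≤m : 1 ≤ m) where

  private
    n = suc (suc m)
    Q = 2 ℕ^ m

  reply : Bool → Str n → Str n
  reply b A = tab n (b ▸ at A)

  reply-differ : ∀ b A → (∃[ i ] (i < n × at A i ≢ b)) → A ≢ reply b A
  reply-differ b A (i , i<n , ne) e = ne (const i i<n)
    where
    const : ∀ i → i < n → at A i ≡ b
    const zero lt = trans (cong (λ C → at C 0) e) (at-tab n (b ▸ at A) 0 lt)
    const (suc i) lt = trans (cong (λ C → at C (suc i)) e) (trans (at-tab n (b ▸ at A) (suc i) lt) (const i (<-trans (n<1+n i) lt)))

  reply-lead : ∀ b A → A ≢ reply b A → conway n (at A) (at A) ≡ conway n (at A) (b ▸ at A) ℕ+ lead A (reply b A)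
  reply-lead b A ne = trans (lead-≡ A (reply b A) ne) (cong (_ℕ+ lead A (reply b A)) (conway-cong n (λ _ _ → refl) (at-tab n (b ▸ at A))))

  reply-lead′ : ∀ b A → A ≢ reply b A → conway n (b ▸ at A) (b ▸ at A) ≡ conway n (b ▸ at A) (at A) ℕ+ lead (reply b A) A
  reply-lead′ b A ne = trans (sym (conway-cong n h h)) (trans (lead-≡ (reply b A) A (ne ∘ sym)) (cong (_ℕ+ lead (reply b A) A) (conway-cong n h (λ _ _ → refl))))
    where
    h = at-tab n (b ▸ at A)

  refuted-reply : ∀ A → Refuted m (at A) → ∃[ B ] (A ≢ B × lead B A * (2 * Q ℕ+ 1) < lead A B * (Q ℕ+ 1))
  refuted-reply A (b , ne , worse) = reply b A , A≢B , worse⇒odds< b ne worse (reply-lead b A A≢B) (reply-lead′ b A A≢B) diff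
    where
    A≢B = reply-differ b A ne
    diff : Differ n (at A) (b ▸ at A)
    diff with ≢⇒differ A (reply b A) A≢B
    ... | i , i<n , d = i , i<n , λ e → d (trans e (sym (at-tab n (b ▸ at A) i i<n)))

  special-reply : ∀ A → SpecialStr m A → ∃[ B ] (A ≢ B × lead B A * (2 * Q ℕ+ 1) ≤ lead A B * (Q ℕ+ 1))
  special-reply A (sp , last) = reply b A , A≢B , special-tight 1≤m sp last (reply-lead b A A≢B) (reply-lead′ b A A≢B)
    where
    b = not (at A 0)
    A≢B = reply-differ b A (0 , s≤s z≤n , not-≢ (at A 0))

  best-reply : ∀ A → ∃[ B ] (A ≢ B × lead B A * (2 * Q ℕ+ 1) ≤ lead A B * (Q ℕ+ 1))
  best-reply A with special-or-refuted m (at A) 1≤m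
  ... | inj₁ sp = special-reply A sp
  ... | inj₂ ref with refuted-reply A ref
  ...   | B , ne , lt = B , ne , <⇒≤ lt

  special-leads : ∀ A → SpecialStr m A → ∀ B → A ≢ B → lead A B * (Q ℕ+ 1) ≤ lead B A * (2 * Q ℕ+ 1)
  special-leads A (sp , last) B ne = special-odds 1≤m sp last (≢⇒differ A B ne) (lead-≡ A B ne) (lead-≡ B A (ne ∘ sym))

  open ≤-Reasoning

  special⇒optimal : ∀ A → SpecialStr m A → Optimal n A
  special⇒optimal A spA A′ with best-reply A′
  ... | B′ , A′≢B′ , le = B′ , A′≢B′ ∘ sym , λ B B≢A → probLe-intro A′≢B′ (B≢A ∘ sym)
      (*-cancelʳ-≤ _ _ (Q ℕ+ 1) {{>-nonZero (≤-trans (m^n>0 2 m) (m≤m+n Q 1))}} (begin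
        lead B′ A′ * lead A B * (Q ℕ+ 1)         ≡⟨ *-assoc (lead B′ A′) (lead A B) (Q ℕ+ 1) ⟩
        lead B′ A′ * (lead A B * (Q ℕ+ 1))       ≤⟨ *-monoʳ-≤ (lead B′ A′) (special-leads A spA B (B≢A ∘ sym)) ⟩
        lead B′ A′ * (lead B A * (2 * Q ℕ+ 1))   ≡⟨ lem (lead B′ A′) (lead B A) (2 * Q ℕ+ 1) ⟩
        lead B A * (lead B′ A′ * (2 * Q ℕ+ 1))   ≤⟨ *-monoʳ-≤ (lead B A) le ⟩
        lead B A * (lead A′ B′ * (Q ℕ+ 1))       ≡⟨ sym (*-assoc (lead B A) (lead A′ B′) (Q ℕ+ 1)) ⟩
        lead B A * lead A′ B′ * (Q ℕ+ 1) ∎))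
    where
    lem : ∀ a b c → a * (b * c) ≡ b * (a * c)
    lem = solve-∀

  -- A refuted string loses to a special S: some reply to A strictly exceeds the critical odds, and
  -- no reply to S does.
  optimal⇒special : 2 ≤ m → ∀ A → Optimal n A → SpecialStr m A
  optimal⇒special 2≤m A opt with special-or-refuted m (at A) 1≤m
  ... | inj₁ sp = sp
  ... | inj₂ ref = contra (specialStr m 2≤m) (refuted-reply A ref)
    where
    lem : ∀ a b c → a * (b * c) ≡ b * (a * c)
    lem = solve-∀
    contra : ∃[ S ] SpecialStr m S → ∃[ B ] (A ≢ B × lead B A * (2 * Q ℕ+ 1) < lead A B * (Q ℕ+ 1)) → SpecialStr m A
    contra (S , spS) (B , A≢B , lt) with opt S
    ... | C , C≢S , le = contradiction (probLe-elim A≢B (C≢S ∘ sym) (le B (A≢B ∘ sym))) (<⇒≱ (*-cancelʳ-< (2 * Q ℕ+ 1) _ _ (begin-strict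
        lead B A * lead S C * (2 * Q ℕ+ 1)   ≡⟨ lem′ (lead B A) (lead S C) (2 * Q ℕ+ 1) ⟩
        lead S C * (lead B A * (2 * Q ℕ+ 1)) <⟨ *-monoʳ-< (lead S C) {{>-nonZero (lead-positive S C (C≢S ∘ sym))}} lt ⟩
        lead S C * (lead A B * (Q ℕ+ 1))     ≡⟨ lem (lead S C) (lead A B) (Q ℕ+ 1) ⟩
        lead A B * (lead S C * (Q ℕ+ 1))     ≤⟨ *-monoʳ-≤ (lead A B) (special-leads S spS C (C≢S ∘ sym)) ⟩
        lead A B * (lead C S * (2 * Q ℕ+ 1)) ≡⟨ lem″ (lead A B) (lead C S) (2 * Q ℕ+ 1) ⟩
        lead C S * lead A B * (2 * Q ℕ+ 1) ∎)))
      where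
      lem′ : ∀ a b c → a * b * c ≡ b * (a * c)
      lem′ = solve-∀
      lem″ : ∀ a b c → a * (b * c) ≡ b * a * c
      lem″ = solve-∀

-- The recurrence

-- A framed word of length 2k + d with its middle d letters removed: u and v are its halves.
record Halves (k : ℕ) (u v : Word) : Set where
  field
    start      : u 1 ≢ u 0
    end        : v (k ∸ 1) ≡ u 0
    end′       : v (k ∸ 2) ≢ u 0
    unbordered : ∀ l → 2 ≤ l → l ≤ k → ends l k u v ≡ false

halves? : ∀ k u v → Dec (Halves k u v)
halves? k u v = map′ (λ (s , e , e′ , ub) → record { start = s ; end = e ; end′ = e′ ; unbordered = λ l 2≤l l≤k → ub (s≤s l≤k) 2≤l })
    (λ hv → let open Halves hv in start , end , end′ , λ {l} l<sk 2≤l → unbordered l 2≤l (s≤s⁻¹ l<sk))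
    (¬? (u 1 ≟B u 0) ×-dec (v (k ∸ 1) ≟B u 0) ×-dec ¬? (v (k ∸ 2) ≟B u 0) ×-dec allUpTo? (λ l → 2 ≤? l →-dec (ends l k u v ≟B false)) (suc k))

module _ {k c m : ℕ} {w u v : Word} (N≡ : c ℕ+ suc (suc k) ≡ suc m)
  (wu : ∀ i → i < suc (suc k) → w i ≡ u i) (wv : ∀ i → i < suc (suc k) → w (c ℕ+ i) ≡ v i) where

  private
    wm : w m ≡ v (suc k)
    wm = trans (cong w (suc-injective (trans (sym N≡) (+-suc c (suc k))))) (wv (suc k) ≤-refl)
    wm′ : w (m ∸ 1) ≡ v k
    wm′ = trans (cong (λ i → w (i ∸ 2)) (trans (sym N≡) (trans (+-suc c (suc k)) (cong suc (+-suc c k))))) (wv k (n≤1+n (suc k)))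
    w0 : w 0 ≡ u 0
    w0 = wu 0 (s≤s z≤n)
    w1 : w 1 ≡ u 1
    w1 = wu 1 (s≤s (s≤s z≤n))
    borders : ∀ l → l ≤ suc (suc k) → border l (suc m) w ≡ ends l (suc (suc k)) u v
    borders l l≤k = trans (cong (λ n → border l n w) (sym N≡)) (trans (ends-offset l c (suc (suc k)) w w l≤k)
      (ends-cong l (suc (suc k)) (λ i i<l → wu i (<-≤-trans i<l l≤k)) wv))

  framed⇒halves : Framed (suc (suc k)) m w → Halves (suc (suc k)) u v
  framed⇒halves fr = record
    { start = λ e → start (trans w1 (trans e (sym w0)))
    ; end = trans (sym wm) (trans end w0)
    ; end′ = λ e → end′ (trans wm′ (trans e (sym w0)))
    ; unbordered = λ l 2≤l l≤k → trans (sym (borders l l≤k)) (unbordered l 2≤l l≤k) }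
    where open Framed fr

  halves⇒framed : Halves (suc (suc k)) u v → Framed (suc (suc k)) m w
  halves⇒framed hv = record
    { start = λ e → start (trans (sym w1) (trans e w0))
    ; end = trans wm (trans end (sym w0))
    ; end′ = λ e → end′ (trans (sym wm′) (trans e w0))
    ; unbordered = λ l 2≤l l≤k → trans (borders l l≤k) (unbordered l 2≤l l≤k) }
    where open Halves hv

[]?-⊎ : ∀ {P Q R : Set} (p : Dec P) (q : Dec Q) (r : Dec R) → (P → Q ⊎ R) → (Q → P) → (R → P) → (Q → R → ⊥) →
  [ p ]? ≡ [ q ]? ℕ+ [ r ]?
[]?-⊎ p (yes q) r f g h disj = trans (cong 𝟙 (dec-true p (g q))) (cong suc (sym ([]?-no r (disj q))))
[]?-⊎ p (no ¬q) r f g h disj = []?-⇔ p r (λ x → [ (λ q → contradiction q ¬q) , (λ r → r) ]′ (f x)) h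

#framed : ℕ → ℕ → ℕ
#framed h m = Σ⟨ suc m ⟩ (λ v → [ framed? h m (at v) ]?)

#special : ℕ → ℕ
#special m = #framed m m

#halves : ℕ → ℕ
#halves k = Σ⟨ k ⟩ λ P → Σ⟨ k ⟩ λ Q → [ halves? k (at P) (at Q) ]?

#framed≡#special : ∀ {h m} → h ≤ m → suc m ≤ 2 * h → #framed h m ≡ #special m
#framed≡#special {h} {m} h≤m le = Σ-cong (suc m) (λ v → []?-⇔ (framed? h m (at v)) (framed? m m (at v)) (framed⇒special le) (framed-mono h≤m))

#framed≡#halves : ∀ k d → #framed (suc (suc k)) (suc k ℕ+ (d ℕ+ suc (suc k))) ≡ 2 ℕ^ d * #halves (suc (suc k))
#framed≡#halves k d = begin
  #framed K (suc k ℕ+ (d ℕ+ K))                 ≡⟨ Σ-++ K (d ℕ+ K) (λ U → [ framed? K m (at U) ]?) ⟩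
  (Σ⟨ K ⟩ λ P → Σ⟨ d ℕ+ K ⟩ λ R → [ framed? K m (at (P ++ᵥ R)) ]?)  ≡⟨ Σ-cong K middle ⟩
  (Σ⟨ K ⟩ λ P → 2 ℕ^ d * Σ⟨ K ⟩ λ Q → [ halves? K (at P) (at Q) ]?) ≡⟨ Σ-* K (2 ℕ^ d) (λ P → Σ⟨ K ⟩ λ Q → [ halves? K (at P) (at Q) ]?) ⟩
  2 ℕ^ d * #halves K ∎
  where
  open ≡-Reasoning
  K = suc (suc k)
  m = suc k ℕ+ (d ℕ+ K)
  middle : ∀ P → (Σ⟨ d ℕ+ K ⟩ λ R → [ framed? K m (at (P ++ᵥ R)) ]?) ≡ 2 ℕ^ d * Σ⟨ K ⟩ λ Q → [ halves? K (at P) (at Q) ]?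
  middle P = trans (Σ-++ d K (λ R → [ framed? K m (at (P ++ᵥ R)) ]?)) (trans (Σ-cong d (λ C → Σ-cong K (λ Q →
      []?-⇔ (framed? K m (at (P ++ᵥ (C ++ᵥ Q)))) (halves? K (at P) (at Q))
        (framed⇒halves {c = K ℕ+ d} (+-assoc K d K) (at-++ˡ P (C ++ᵥ Q)) (at-Q C Q))
        (halves⇒framed {c = K ℕ+ d} (+-assoc K d K) (at-++ˡ P (C ++ᵥ Q)) (at-Q C Q)))))
      (Σ-const d _))
    where
    at-Q : ∀ C Q i → i < K → at (P ++ᵥ (C ++ᵥ Q)) (K ℕ+ d ℕ+ i) ≡ at Q i
    at-Q C Q i _ = trans (cong (at (P ++ᵥ (C ++ᵥ Q))) (+-assoc K d i)) (trans (at-++ʳ P (C ++ᵥ Q) (d ℕ+ i)) (at-++ʳ C Q i))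

module _ {h k j : ℕ} {u : Word} (h≤k : h ≤ suc (suc k)) (per : ∀ i → i < suc (suc k) → u i ≡ u (i ℕ+ j)) where

  private
    borders : ∀ l → l ≤ h → border l (suc (suc k ℕ+ j)) u ≡ border l (suc (suc k)) u
    borders l l≤h = trans (cong (λ n → border l n u) (+-comm (suc (suc k)) j))
      (trans (ends-offset l j (suc (suc k)) u u (≤-trans l≤h h≤k))
        (ends-cong l (suc (suc k)) (λ _ _ → refl) (λ i i<K → trans (cong u (+-comm j i)) (sym (per i i<K)))))

  -- The long word begins and ends with its prefix of length k + 2, so both have the same first and
  -- last letters and the same borders up to `h`.
  framed-period⁻ : Framed h (suc k ℕ+ j) u → Framed h (suc k) u
  framed-period⁻ fr = record
    { start = start
    ; end = trans (per (suc k) ≤-refl) end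
    ; end′ = λ e → end′ (trans (sym (per k (n≤1+n (suc k)))) e)
    ; unbordered = λ l 2≤l l≤h → trans (sym (borders l l≤h)) (unbordered l 2≤l l≤h) }
    where open Framed fr

  framed-period⁺ : Framed h (suc k) u → Framed h (suc k ℕ+ j) u
  framed-period⁺ fr = record
    { start = start
    ; end = trans (sym (per (suc k) ≤-refl)) end
    ; end′ = λ e → end′ (trans (per k (n≤1+n (suc k))) e)
    ; unbordered = λ l 2≤l l≤h → trans (borders l l≤h) (unbordered l 2≤l l≤h) }
    where open Framed fr

-- The two occurrences of the border share c ≤ 1 letters, so the border determines the word.
#bordered : ∀ {c k j} → c ≤ 1 → c ℕ+ j ≡ suc (suc k) →
  Σ⟨ suc (suc k ℕ+ j) ⟩ (λ U → [ framed? (suc k) (suc k ℕ+ j) (at U) ×-dec (border (suc (suc k)) (suc (suc k ℕ+ j)) (at U) ≟B true) ]?)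
    ≡ #special (suc k)
#bordered {c} {k} {j} c≤1 cj = trans (Σ-++ K j f) (Σ-cong K λ V → trans (Σ-single (Z₀ V) (λ Z ne → []?-no (bordered? V Z) (ne ∘ determined V Z ∘ proj₂)))
    ([]?-⇔ (bordered? V (Z₀ V)) (framed? (suc k) (suc k) (at V)) (to V) (from V)))
  where
  K = suc (suc k)
  m = suc k ℕ+ j
  f : Vec Bool (K ℕ+ j) → ℕ
  f U = [ framed? (suc k) m (at U) ×-dec (border K (suc m) (at U) ≟B true) ]?
  -- The final copy of V starts at position j, and K = c + j; hence the letters after the initial
  -- copy repeat V from position c on.
  Z₀ : Vec Bool K → Vec Bool j
  Z₀ V = tab j (λ i → at V (c ℕ+ i))
  bordered? : ∀ V Z → Dec _
  bordered? V Z = framed? (suc k) m (at (V ++ᵥ Z)) ×-dec (border K (suc m) (at (V ++ᵥ Z)) ≟B true)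
  c+<K : ∀ i → i < j → c ℕ+ i < K
  c+<K i i<j = ≤-trans (+-monoʳ-< c i<j) (≤-reflexive cj)
  shift : ∀ i → K ℕ+ i ≡ c ℕ+ i ℕ+ j
  shift i = trans (cong (_ℕ+ i) (sym cj)) (trans (+-assoc c j i) (trans (cong (c ℕ+_) (+-comm j i)) (sym (+-assoc c i j))))
  determined : ∀ V Z → border K (suc m) (at (V ++ᵥ Z)) ≡ true → Z ≡ Z₀ V
  determined V Z h = at-injective Z (Z₀ V) λ i i<j → let U = at (V ++ᵥ Z) in begin
    at Z i                       ≡⟨ sym (at-++ʳ V Z i) ⟩
    at (V ++ᵥ Z) (K ℕ+ i)        ≡⟨ cong (at (V ++ᵥ Z)) (shift i) ⟩
    at (V ++ᵥ Z) (c ℕ+ i ℕ+ j)   ≡⟨ sym (ends⇒ K j {U} {U} h (c ℕ+ i) (c+<K i i<j)) ⟩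
    at (V ++ᵥ Z) (c ℕ+ i)        ≡⟨ at-++ˡ V Z (c ℕ+ i) (c+<K i i<j) ⟩
    at V (c ℕ+ i)                ≡⟨ sym (at-tab j (λ i → at V (c ℕ+ i)) i i<j) ⟩
    at (Z₀ V) i ∎
    where open ≡-Reasoning
  to : ∀ V → Framed (suc k) m (at (V ++ᵥ Z₀ V)) × border K (suc m) (at (V ++ᵥ Z₀ V)) ≡ true → Framed (suc k) (suc k) (at V)
  to V (fr , h) = framed-cong (n≤1+n (suc k)) (s≤s z≤n) (at-++ˡ V (Z₀ V)) (framed-period⁻ {j = j} (n≤1+n (suc k)) (ends⇒ K j {at (V ++ᵥ Z₀ V)} {at (V ++ᵥ Z₀ V)} h) fr)
  from : ∀ V → Framed (suc k) (suc k) (at V) → Framed (suc k) m (at (V ++ᵥ Z₀ V)) × border K (suc m) (at (V ++ᵥ Z₀ V)) ≡ true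
  from V fr = framed-period⁺ {j = j} (n≤1+n (suc k)) per (framed-cong (n≤1+n (suc k)) (s≤s z≤n) (λ i i<K → sym (at-++ˡ V (Z₀ V) i i<K)) fr) , ends⇐ K j per
    where
    U = V ++ᵥ Z₀ V
    -- For c = 1 the two occurrences of V share the letter at j = k + 1, the last and first one of V.
    shared : ∀ i → i < K → i ℕ+ j < K → at V i ≡ at V (i ℕ+ j)
    shared i i<K lt = go c i c≤1 cj lt
      where
      go : ∀ c i → c ≤ 1 → c ℕ+ j ≡ K → i ℕ+ j < K → at V i ≡ at V (i ℕ+ j)
      go zero i _ refl lt = contradiction (≤-trans (s≤s (m≤n+m j i)) lt) (n≮n j)
      go (suc zero) zero _ refl lt = sym (Framed.end fr)
      go (suc zero) (suc i) _ refl lt = contradiction (≤-trans (s≤s (s≤s (m≤n+m j i))) lt) (n≮n (suc j))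
      go (suc (suc c)) i (s≤s ()) _ _
    per : ∀ i → i < K → at U i ≡ at U (i ℕ+ j)
    per i i<K with i ℕ+ j <? K
    ... | yes lt = trans (at-++ˡ V (Z₀ V) i i<K) (trans (shared i i<K lt) (sym (at-++ˡ V (Z₀ V) (i ℕ+ j) lt)))
    ... | no ge = begin
        at U i              ≡⟨ at-++ˡ V (Z₀ V) i i<K ⟩
        at V i              ≡⟨ cong (at V) (sym ci′) ⟩
        at V (c ℕ+ i′)      ≡⟨ sym (at-tab j (λ i → at V (c ℕ+ i)) i′ i′<j) ⟩
        at (Z₀ V) i′        ≡⟨ sym (at-++ʳ V (Z₀ V) i′) ⟩
        at U (K ℕ+ i′)      ≡⟨ cong (at U) Ki′ ⟩
        at U (i ℕ+ j) ∎
      where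
      open ≡-Reasoning
      i′ = i ℕ+ j ∸ K
      Ki′ : K ℕ+ i′ ≡ i ℕ+ j
      Ki′ = m+[n∸m]≡n (≮⇒≥ ge)
      i′<j : i′ < j
      i′<j = +-cancelˡ-< K _ _ (≤-trans (≤-reflexive (cong suc Ki′)) (+-monoˡ-< j i<K))
      ci′ : c ℕ+ i′ ≡ i
      ci′ = +-cancelʳ-≡ j _ _ (trans (sym (shift i′)) Ki′)

-- The equations force c + d = 2, so with K = k + 2 the length is 2K + d ≤ 2(K + 1). Borders up to K
-- + 1 therefore decide whether a word is special, and the halves control all of them except K + 1.
-- The offset of the second copy of that border is j, its overlap with the first is c.
special-recurrence : ∀ {c d j} k → c ≤ 1 → c ℕ+ j ≡ suc (suc (suc k)) → suc j ≡ d ℕ+ suc (suc k) →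
  #special (suc (suc k) ℕ+ j) ℕ+ #special (suc (suc k)) ≡ 2 ℕ^ d * #halves (suc (suc k))
special-recurrence {c} {d} {j} k c≤1 cj dj = begin
  #special m ℕ+ #special K                ≡⟨ cong₂ _ℕ+_ (sym (#framed≡#special {suc K} h≤m m≤2h)) (sym (#bordered c≤1 cj)) ⟩
  Σ⟨ suc m ⟩ f ℕ+ Σ⟨ suc m ⟩ g            ≡⟨ sym (Σ-+ (suc m) f g) ⟩
  Σ⟨ suc m ⟩ (λ U → f U ℕ+ g U)           ≡⟨ Σ-cong (suc m) (λ U → sym (split (at U))) ⟩
  #framed K m                   ≡⟨ cong (#framed K) (trans (sym (+-suc (suc k) j)) (cong (suc k ℕ+_) dj)) ⟩
  #framed K (suc k ℕ+ (d ℕ+ K)) ≡⟨ #framed≡#halves k d ⟩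
  2 ℕ^ d * #halves K ∎
  where
  open ≡-Reasoning
  K = suc (suc k)
  m = K ℕ+ j
  f g : Vec Bool (suc m) → ℕ
  f U = [ framed? (suc K) m (at U) ]?
  g U = [ framed? K m (at U) ×-dec (border (suc K) (suc m) (at U) ≟B true) ]?
  1≤j : 1 ≤ j
  1≤j = +-cancelˡ-≤ 1 1 j (≤-trans (≤-trans (s≤s (s≤s z≤n)) (≤-reflexive (sym cj))) (+-monoˡ-≤ j c≤1))
  h≤m : suc K ≤ m
  h≤m = ≤-trans (≤-reflexive (+-comm 1 K)) (+-monoʳ-≤ K 1≤j)
  m≤2h : suc m ≤ 2 * suc K
  m≤2h = +-monoʳ-≤ (suc K) (≤-trans (m≤n+m j c) (≤-trans (≤-reflexive cj) (m≤m+n (suc K) 0)))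
  split : ∀ u → [ framed? K m u ]? ≡ [ framed? (suc K) m u ]? ℕ+ [ framed? K m u ×-dec (border (suc K) (suc m) u ≟B true) ]?
  split u = []?-⊎ (framed? K m u) (framed? (suc K) m u) (framed? K m u ×-dec (border (suc K) (suc m) u ≟B true))
      extend (framed-mono (n≤1+n K)) proj₁
      (λ fr (_ , h) → contradiction (trans (sym h) (Framed.unbordered fr (suc K) (s≤s (s≤s z≤n)) ≤-refl)) λ ())
    where
    extend : Framed K m u → Framed (suc K) m u ⊎ (Framed K m u × border (suc K) (suc m) u ≡ true)
    extend fr with border (suc K) (suc m) u ≟B true
    ... | yes h = inj₂ (fr , h)
    ... | no ne = inj₁ (record { Framed fr ; unbordered = unb })
      where
      unb : ∀ l → 2 ≤ l → l ≤ suc K → border l (suc m) u ≡ false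
      unb l 2≤l l≤sK with m≤n⇒m<n∨m≡n l≤sK
      ... | inj₁ (s≤s l≤K) = Framed.unbordered fr l 2≤l l≤K
      ... | inj₂ refl = ¬-not ne

-- The last letter of a special string repeats its first one, so summing over it leaves a sum over
-- A′.
#optimal : ∀ {m c} → 2 ≤ m → Count (Optimal (suc (suc m))) c → c ≡ #special m
#optimal {m} {c} 2≤m cnt = begin
  c                                   ≡⟨ count-Σ optimal? cnt ⟩
  Σ⟨ suc (suc m) ⟩ (λ A → [ special? (at A) ]?) ≡⟨ cong (λ N → Σ⟨ N ⟩ (λ A → [ special? (at A) ]?)) (+-comm 1 (suc m)) ⟩
  Σ⟨ suc m ℕ+ 1 ⟩ (λ A → [ special? (at A) ]?) ≡⟨ Σ-++ (suc m) 1 (λ A → [ special? (at A) ]?) ⟩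
  (Σ⟨ suc m ⟩ λ V → Σ⟨ 1 ⟩ λ Z → [ special? (at (V ++ᵥ Z)) ]?) ≡⟨ Σ-cong (suc m) (λ V → trans
      (Σ-single (at V 0 ∷ []) (λ Z ne → []?-no (special? (at (V ++ᵥ Z))) (ne ∘ determined V Z ∘ proj₂)))
      ([]?-⇔ (special? (at (V ++ᵥ (at V 0 ∷ [])))) (framed? m m (at V))
        (framed-cong (n≤1+n m) 1≤m (at-++ˡ V _) ∘ proj₁)
        (λ sp → framed-cong (n≤1+n m) 1≤m (λ i i≤m → sym (at-++ˡ V _ i i≤m)) sp , trans (last V _) (sym (at-++ˡ V _ 0 (s≤s z≤n)))))) ⟩
  #special m ∎
  where
  open ≡-Reasoning
  1≤m : 1 ≤ m
  1≤m = ≤-trans (s≤s z≤n) 2≤m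
  special? : ∀ u → Dec (Special m u × u (suc m) ≡ u 0)
  special? u = framed? m m u ×-dec (u (suc m) ≟B u 0)
  optimal? : ∀ A → Dec (Optimal (suc (suc m)) A)
  optimal? A = map′ (special⇒optimal 1≤m A) (optimal⇒special 1≤m 2≤m A) (special? (at A))
  last : ∀ V z → at (V ++ᵥ (z ∷ [])) (suc m) ≡ z
  last V z = trans (cong (at (V ++ᵥ (z ∷ []))) (sym (+-identityʳ (suc m)))) (at-++ʳ V (z ∷ []) 0)
  determined : ∀ (V : Vec Bool (suc m)) (Z : Vec Bool 1) → at (V ++ᵥ Z) (suc m) ≡ at (V ++ᵥ Z) 0 → Z ≡ at V 0 ∷ []
  determined V (z ∷ []) e = cong (_∷ []) (trans (sym (last V z)) (trans e (at-++ˡ V (z ∷ []) 0 (s≤s z≤n))))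

-- With no middle letters the halves have exactly half the length, so there is no border K + 1 left
-- to subtract.
#halves≡#special : ∀ k → #halves (suc (suc k)) ≡ #special (suc k ℕ+ suc (suc k))
#halves≡#special k = trans (sym (+-identityʳ _)) (trans (sym (#framed≡#halves k 0))
  (#framed≡#special (m≤n+m (suc (suc k)) (suc k)) (≤-reflexive (cong (suc (suc k) ℕ+_) (sym (+-identityʳ (suc (suc k))))))))

even-odd : ∀ n → (∃[ i ] n ≡ i ℕ+ i) ⊎ (∃[ i ] n ≡ suc (i ℕ+ i))
even-odd zero = inj₁ (0 , refl)
even-odd (suc n) with even-odd n
... | inj₁ (i , refl) = inj₂ (i , refl)
... | inj₂ (i , refl) = inj₁ (suc i , cong suc (sym (+-suc i i)))

double : ∀ K → suc (suc (K ℕ+ K)) ≡ suc K * 2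
double = solve-∀

half-even : ∀ K → suc (suc (K ℕ+ K)) / 2 ≡ suc K
half-even K = trans (cong (_/ 2) (double K)) (m*n/n≡m (suc K) 2)

half-odd : ∀ K → suc (suc (suc (K ℕ+ K))) / 2 ≡ suc K
half-odd K = trans (cong (λ z → suc z / 2) (double K)) (trans (+-distrib-/-∣ʳ 1 {suc K * 2} {2} (n∣m*n (suc K))) (m*n/n≡m (suc K) 2))

sign-even : ∀ K → -[1+ 0 ] ^ suc (suc (K ℕ+ K)) ≡ + 1
sign-even K = trans (cong (-[1+ 0 ] ^_) (trans (double K) (*-comm (suc K) 2)))
  (trans (sym (ℤ.^-*-assoc -[1+ 0 ] 2 (suc K))) (ℤ.^-zeroˡ (suc K)))

even-case : ∀ k {n} → n ≡ suc (suc (suc (suc k) ℕ+ suc (suc k))) → ∀ cn cn-1 ch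
  → Count (Optimal n) cn → Count (Optimal (n ∸ 1)) cn-1 → Count (Optimal (n / 2 ℕ+ 1)) ch
  → + cn + (-[1+ 0 ] ^ n) *ℤ (+ ch) ≡ + (2 * cn-1)
even-case k refl cn cn-1 ch Cn Cn-1 Ch = begin
  + cn + (-[1+ 0 ] ^ suc (suc (K ℕ+ K))) *ℤ (+ ch) ≡⟨ cong (λ s → + cn + s *ℤ (+ ch)) (sign-even K) ⟩
  + cn + + 1 *ℤ (+ ch)                            ≡⟨ cong (_+_ (+ cn)) (ℤ.*-identityˡ (+ ch)) ⟩
  + (cn ℕ+ ch)                                    ≡⟨ cong +_ nat ⟩
  + (2 * cn-1) ∎
  where
  open ≡-Reasoning
  K = suc (suc k)
  nat : cn ℕ+ ch ≡ 2 * cn-1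
  nat = begin
    cn ℕ+ ch                          ≡⟨ cong₂ _ℕ+_ (#optimal (s≤s (s≤s z≤n)) Cn) (#optimal (s≤s (s≤s z≤n))
                                           (subst (λ h → Count (Optimal h) ch) (trans (cong (_ℕ+ 1) (half-even K)) (+-comm (suc K) 1)) Ch)) ⟩
    #special (K ℕ+ K) ℕ+ #special K   ≡⟨ special-recurrence {1} {1} k (s≤s z≤n) refl refl ⟩
    2 * #halves K                     ≡⟨ cong (2 *_) (#halves≡#special k) ⟩
    2 * #special (suc k ℕ+ K)         ≡⟨ cong (2 *_) (sym (#optimal (s≤s (≤-trans (s≤s z≤n) (m≤n+m K k))) Cn-1)) ⟩
    2 * cn-1 ∎

odd-case : ∀ k {n} → n ≡ suc (suc (suc (suc (suc k) ℕ+ suc (suc k)))) → ∀ cn cn-1 ch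
  → Count (Optimal n) cn → Count (Optimal (n ∸ 1)) cn-1 → Count (Optimal (n / 2 ℕ+ 1)) ch
  → + cn + (-[1+ 0 ] ^ n) *ℤ (+ ch) ≡ + (2 * cn-1)
odd-case k refl cn cn-1 ch Cn Cn-1 Ch = begin
  + cn + (-[1+ 0 ] *ℤ (-[1+ 0 ] ^ suc (suc (K ℕ+ K)))) *ℤ (+ ch) ≡⟨ cong (λ s → + cn + (-[1+ 0 ] *ℤ s) *ℤ (+ ch)) (sign-even K) ⟩
  + cn + -[1+ 0 ] *ℤ (+ ch)           ≡⟨ cong₂ (λ a b → + a + b) nat (ℤ.-1*i≡-i (+ ch)) ⟩
  + (2 * cn-1) + + ch + - (+ ch)      ≡⟨ ℤ.+-assoc (+ (2 * cn-1)) (+ ch) (- (+ ch)) ⟩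
  + (2 * cn-1) + (+ ch + - (+ ch))    ≡⟨ cong (_+_ (+ (2 * cn-1))) (ℤ.+-inverseʳ (+ ch)) ⟩
  + (2 * cn-1) + + 0                  ≡⟨ ℤ.+-identityʳ (+ (2 * cn-1)) ⟩
  + (2 * cn-1) ∎
  where
  open ≡-Reasoning
  K = suc (suc k)
  ch≡ : ch ≡ #special K
  ch≡ = #optimal (s≤s (s≤s z≤n)) (subst (λ h → Count (Optimal h) ch) (trans (cong (_ℕ+ 1) (half-odd K)) (+-comm (suc K) 1)) Ch)
  lem₁ : ∀ h → 4 * h ≡ 2 * (2 * h)
  lem₁ = solve-∀
  lem₂ : ∀ s c → 2 * (s ℕ+ c) ≡ 2 * s ℕ+ c ℕ+ c
  lem₂ = solve-∀
  nat : cn ≡ 2 * cn-1 ℕ+ ch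
  nat = +-cancelʳ-≡ ch _ _ (begin
    cn ℕ+ ch                              ≡⟨ cong₂ _ℕ+_ (trans (#optimal (s≤s (s≤s z≤n)) Cn) (cong #special (sym (+-suc K K)))) ch≡ ⟩
    #special (K ℕ+ suc K) ℕ+ #special K   ≡⟨ special-recurrence {0} {2} k z≤n refl refl ⟩
    4 * #halves K                         ≡⟨ lem₁ (#halves K) ⟩
    -- The word one letter shorter has a single middle letter, so 2h brings in `cn-1` together with
    -- `ch`. Doubling yields `ch` twice; one copy cancels and the other gives the opposite sign.
    2 * (2 * #halves K)                   ≡⟨ cong (2 *_) (sym (special-recurrence {1} {1} k (s≤s z≤n) refl refl)) ⟩
    2 * (#special (K ℕ+ K) ℕ+ #special K) ≡⟨ cong₂ (λ a b → 2 * (a ℕ+ b)) (sym (#optimal (s≤s (s≤s z≤n)) Cn-1)) (sym ch≡) ⟩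
    2 * (cn-1 ℕ+ ch)                      ≡⟨ lem₂ cn-1 ch ⟩
    2 * cn-1 ℕ+ ch ℕ+ ch ∎)

theorem1p1 : ∀ (n : ℕ) → 6 ≤ n → ∀ (cn cn-1 ch : ℕ)
    → Count (Optimal n) cn
    → Count (Optimal (n ∸ 1)) cn-1
    → Count (Optimal (n / 2 ℕ+ 1)) ch
    → + cn + (-[1+ 0 ] ^ n) *ℤ (+ ch) ≡ + (2 * cn-1)
-- Subtracting 6 makes the halves i + 2 letters long, enough to hold the two letters that `start`
-- and the two that `end` and `end′` speak of.
theorem1p1 n 6≤n with even-odd (n ∸ 6)
... | inj₁ (i , e) = even-case i (trans (sym (m+[n∸m]≡n 6≤n)) (trans (cong (6 ℕ+_) e) (lem i)))
  where
  lem : ∀ i → 6 ℕ+ (i ℕ+ i) ≡ suc (suc (suc (suc i) ℕ+ suc (suc i)))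
  lem = solve-∀
... | inj₂ (i , e) = odd-case i (trans (sym (m+[n∸m]≡n 6≤n)) (trans (cong (6 ℕ+_) e) (lem i)))
  where
  lem : ∀ i → 6 ℕ+ suc (i ℕ+ i) ≡ suc (suc (suc (suc (suc i) ℕ+ suc (suc i))))
  lem = solve-∀
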